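{- Let $m>3$. Let $V=\mathbb{F}_4^m$ carry a nondegenerate Hermitian form $h$ (with respect to the involution $a\mapsto a^2$). Let $\mathrm{NU}_m(2)$ be the graph whose vertices are the $1$-dimensional subspaces $\langle x\rangle$ of $V$ with $h(x,x)\neq 0$, two distinct vertices being adjacent if the $2$-dimensional subspace they span contains exactly one $1$-dimensional subspace $\langle z\rangle$ with $h(z,z)=0$ (i.e. the line they span is tangent to the Hermitian variety). Then $\mathrm{NU}_m(2)$ is separating.
   Context: A graph $\Gamma$ is separating if $\omega(\Gamma)\alpha(\Gamma)<|V(\Gamma)|$, where $\omega$ and $\alpha$ are the maximum clique and coclique sizes. -}

module Defs where

open import Data.Nat using (ℕ; _*_; _<_)
open import Data.Vec using (Vec; []; _∷_; replicate; zipWith; map)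
open import Data.List using (List; length)
open import Data.List.Relation.Unary.All using (All)
open import Data.List.Relation.Unary.Any using (Any)
open import Data.List.Relation.Unary.AllPairs using (AllPairs)
open import Data.Product using (Σ; ∃; _×_; _,_)
open import Relation.Binary.PropositionalEquality using (_≡_; _≢_)
open import Relation.Nullary using (¬_)

-- The field F₄ = {0, 1, ω, ω²} with ω² = ω + 1.

data F4 : Set where
  𝟘 𝟙 ω ω² : F4

infixl 6 _⊕_
infixl 7 _⊗_

_⊕_ : F4 → F4 → F4
𝟘  ⊕ y  = y
𝟙  ⊕ 𝟘  = 𝟙
𝟙  ⊕ 𝟙  = 𝟘
𝟙  ⊕ ω  = ω²
𝟙  ⊕ ω² = ω
ω  ⊕ 𝟘  = ω
ω  ⊕ 𝟙  = ω²
ω  ⊕ ω  = 𝟘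
ω  ⊕ ω² = 𝟙
ω² ⊕ 𝟘  = ω²
ω² ⊕ 𝟙  = ω
ω² ⊕ ω  = 𝟙
ω² ⊕ ω² = 𝟘

_⊗_ : F4 → F4 → F4
𝟘  ⊗ y  = 𝟘
𝟙  ⊗ y  = y
ω  ⊗ 𝟘  = 𝟘
ω  ⊗ 𝟙  = ω
ω  ⊗ ω  = ω²
ω  ⊗ ω² = 𝟙
ω² ⊗ 𝟘  = 𝟘
ω² ⊗ 𝟙  = ω²
ω² ⊗ ω  = 𝟙
ω² ⊗ ω² = ω

conj : F4 → F4
conj a = a ⊗ a

V : ℕ → Set
V m = Vec F4 m

0v : ∀ {m} → V m
0v = replicate _ 𝟘

_+v_ : ∀ {m} → V m → V m → V m
_+v_ = zipWith _⊕_

_·v_ : ∀ {m} → F4 → V m → V m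
a ·v x = map (a ⊗_) x

record HermitianForm (m : ℕ) : Set where
  field
    h        : V m → V m → F4
    additive : ∀ x y z → h (x +v y) z ≡ h x z ⊕ h y z
    homog    : ∀ a x y → h (a ·v x) y ≡ a ⊗ h x y
    hermit   : ∀ x y → h y x ≡ conj (h x y)

Nondegenerate : ∀ {m} → HermitianForm m → Set
Nondegenerate {m} H = ∀ (x : V m) → (∀ y → HermitianForm.h H x y ≡ 𝟘) → x ≡ 0v

-- Projective points: ⟨x⟩ = ⟨y⟩ for nonzero x, y iff y = c x with c ≠ 0.

SamePoint : ∀ {m} → V m → V m → Set
SamePoint x y = Σ F4 λ c → c ≢ 𝟘 × y ≡ c ·v x

InSpan : ∀ {m} → V m → V m → V m → Set
InSpan x y z = Σ F4 λ a → Σ F4 λ b → z ≡ (a ·v x) +v (b ·v y)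

module NU {m : ℕ} (H : HermitianForm m) where
  open HermitianForm H

  Isotropic : V m → Set
  Isotropic z = h z z ≡ 𝟘

  -- vertices of NU_m(2): points ⟨x⟩ with h(x,x) ≠ 0 (x ≠ 0 follows).
  IsVertex : V m → Set
  IsVertex x = x ≢ 0v × h x x ≢ 𝟘

  ExactlyOneIsotropicPoint : V m → V m → Set
  ExactlyOneIsotropicPoint x y =
    Σ (V m) λ z → InSpan x y z × z ≢ 0v × Isotropic z ×
      (∀ z' → InSpan x y z' → z' ≢ 0v → Isotropic z' → SamePoint z z')

  Adj : V m → V m → Set
  Adj x y = ¬ SamePoint x y × ExactlyOneIsotropicPoint x y

  IsVertexSet : List (V m) → Set
  IsVertexSet L = All IsVertex L × AllPairs (λ x y → ¬ SamePoint x y) L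

  IsClique : List (V m) → Set
  IsClique L = IsVertexSet L × AllPairs Adj L

  IsCoclique : List (V m) → Set
  IsCoclique L = IsVertexSet L × AllPairs (λ x y → ¬ Adj x y) L

  CliqueNumber : ℕ → Set
  CliqueNumber k = (Σ (List (V m)) λ L → IsClique L × length L ≡ k)
                 × (∀ L → IsClique L → length L Data.Nat.≤ k)

  CocliqueNumber : ℕ → Set
  CocliqueNumber k = (Σ (List (V m)) λ L → IsCoclique L × length L ≡ k)
                   × (∀ L → IsCoclique L → length L Data.Nat.≤ k)

  VertexCount : ℕ → Set
  VertexCount n = Σ (List (V m)) λ L → IsVertexSet L ×
                    (∀ x → IsVertex x → Any (SamePoint x) L) × length L ≡ n

  Separating : Set
  Separating = Σ ℕ λ w → Σ ℕ λ a → Σ ℕ λ n →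
                 CliqueNumber w × CocliqueNumber a × VertexCount n × w * a < n

{-# OPTIONS --safe #-}

-- On vectors of norm 1, adjacency means non-orthogonality.  A coclique is therefore an orthonormal
-- system and has at most m elements.  A clique of size k spans 3k vectors; Parseval's identity for
-- the Fourier transform of their indicator function gives k(k + 3) ≤ 4ᵐ, hence k + 2 ≤ 2ᵐ.  The
-- quadratic Gauss sum of v ↦ h(v,v) squares to 4ᵐ, so there are at least (4ᵐ - 2ᵐ)/6 vertices.
-- These three bounds suffice when m ≥ 5.  When m = 4 they leave open cliques of size 10 or more
-- (there are 40 vertices); a clique containing x₀ corresponds to a set of isotropic vectors t of
-- the Hermitian space F₄³ = x₀^⊥ with pairwise products ≠ 1, and a search over its 28 isotropic
-- vectors bounds such sets.

module Submission where

open import Defs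
import Data.Nat as ℕ
open import Data.Nat using (ℕ; zero; suc; _<_)
import Data.Nat.Properties as ℕ
import Data.Nat.Tactic.RingSolver as ℕ-Solver
open import Data.Integer.Base
  using (ℤ; +_; -[1+_]; -_; 0ℤ; 1ℤ; -1ℤ; _+_; _*_; _≤_; +≤+; -≤+; nonNegative)
import Data.Integer.Properties as ℤ
open import Data.Integer.Tactic.RingSolver using (solve-∀)
open import Data.Vec using (Vec; []; _∷_; toList; fromList)
import Data.Vec.Properties as Vec
open import Data.List using (List; []; _∷_; length; filter; cartesianProductWith)
import Data.List.Properties as List
open import Data.List.Membership.Propositional using (_∈_)
open import Data.List.Membership.Propositional.Properties
  using (∈-filter⁺; ∈-filter⁻; ∈-cartesianProductWith⁺)
open import Data.List.Relation.Unary.All as All using (All; []; _∷_)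
import Data.List.Relation.Unary.All.Properties as All
open import Data.List.Relation.Unary.AllPairs as AllPairs using (AllPairs; []; _∷_; allPairs?)
import Data.List.Relation.Unary.AllPairs.Properties as AllPairs
open import Data.List.Relation.Unary.Any using (Any; here; there; any?)
open import Data.Product using (∃; _×_; _,_; proj₁; proj₂)
open import Data.Sum using (_⊎_; inj₁; inj₂)
open import Function using (_∘_)
open import Relation.Binary using (Decidable; DecidableEquality; Symmetric)
open import Relation.Binary.PropositionalEquality
open import Relation.Nullary using (¬_; Dec; yes; no; contradiction; ¬?)
open import Relation.Nullary.Decidable
  using (map′; from-yes; _→-dec_; _×-dec_; decidable-stable)

-- Exhaustive search

-- Every nonzero t of F₄ satisfies t·t̄ = 1. Hence the Gram determinant 1 - t·t̄ of two vectors of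
-- norm 1 with product t vanishes exactly when t ≠ 0, which is why tangency is non-orthogonality. A
-- clique also has a rigid Fourier transform for this form: at a nonzero multiple of a clique
-- vector, each clique point contributes a sum of `χ` over the nonzero scalars, which is -1. For m =
-- 4 the Fourier bound k(k + 3) ≤ 256 still allows k = 14, and 14·4 = 56 exceeds 40. The search must
-- therefore bring k down to 9, the largest value with 4k < 40. `Separating` asks for the exact
-- clique number, coclique number and vertex count as data. Extremal lists are obtained by deciding
-- finite searches, and the bounds are then applied to these lists.

Searchable : Set → Set₁
Searchable A = ∀ {P : A → Set} → (∀ x → Dec (P x)) → Dec (∃ P)

all? : ∀ {A} → Searchable A → ∀ {P : A → Set} → (∀ x → Dec (P x)) → Dec (∀ x → P x)
all? any? P? with any? (¬? ∘ P?)
... | yes (x , ¬p) = no λ p → ¬p (p x)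
... | no ¬ex = yes λ x → decidable-stable (P? x) λ ¬p → ¬ex (x , ¬p)

any-F4? : Searchable F4
any-F4? P? with P? 𝟘 | P? 𝟙 | P? ω | P? ω²
... | yes p | _ | _ | _ = yes (_ , p)
... | no _ | yes p | _ | _ = yes (_ , p)
... | no _ | no _ | yes p | _ = yes (_ , p)
... | no _ | no _ | no _ | yes p = yes (_ , p)
... | no p | no q | no r | no s = no λ where
  (𝟘 , t) → p t
  (𝟙 , t) → q t
  (ω , t) → r t
  (ω² , t) → s t

any-Vec? : ∀ {A} → Searchable A → ∀ n → Searchable (Vec A n)
any-Vec? any? zero P? = map′ ([] ,_) (λ { ([] , p) → p }) (P? [])
any-Vec? any? (suc n) P? =
  map′ (λ { (x , xs , p) → x ∷ xs , p }) (λ { (x ∷ xs , p) → x , xs , p })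
    (any? λ x → any-Vec? any? n λ xs → P? (x ∷ xs))

∀F4? : ∀ {P : F4 → Set} → (∀ x → Dec (P x)) → Dec (∀ x → P x)
∀F4? = all? any-F4?

infix 4 _≟_ _≟ᵛ_

_≟_ : DecidableEquality F4
𝟘 ≟ 𝟘 = yes refl
𝟘 ≟ 𝟙 = no λ ()
𝟘 ≟ ω = no λ ()
𝟘 ≟ ω² = no λ ()
𝟙 ≟ 𝟘 = no λ ()
𝟙 ≟ 𝟙 = yes refl
𝟙 ≟ ω = no λ ()
𝟙 ≟ ω² = no λ ()
ω ≟ 𝟘 = no λ ()
ω ≟ 𝟙 = no λ ()
ω ≟ ω = yes refl
ω ≟ ω² = no λ ()
ω² ≟ 𝟘 = no λ ()
ω² ≟ 𝟙 = no λ ()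
ω² ≟ ω = no λ ()
ω² ≟ ω² = yes refl

_≟ᵛ_ : ∀ {m} → DecidableEquality (V m)
_≟ᵛ_ = Vec.≡-dec _≟_

-- Arithmetic of F₄

⊕-identityʳ : ∀ a → a ⊕ 𝟘 ≡ a
⊕-identityʳ = from-yes (∀F4? λ a → a ⊕ 𝟘 ≟ a)

⊕-self : ∀ a → a ⊕ a ≡ 𝟘
⊕-self = from-yes (∀F4? λ a → a ⊕ a ≟ 𝟘)

⊕-cancel : ∀ a b → a ⊕ b ≡ 𝟘 → a ≡ b
⊕-cancel = from-yes (∀F4? λ a → ∀F4? λ b → (a ⊕ b ≟ 𝟘) →-dec (a ≟ b))

⊗-assoc : ∀ a b c → (a ⊗ b) ⊗ c ≡ a ⊗ (b ⊗ c)
⊗-assoc = from-yes (∀F4? λ a → ∀F4? λ b → ∀F4? λ c → (a ⊗ b) ⊗ c ≟ a ⊗ (b ⊗ c))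

⊗-zeroʳ : ∀ a → a ⊗ 𝟘 ≡ 𝟘
⊗-zeroʳ = from-yes (∀F4? λ a → a ⊗ 𝟘 ≟ 𝟘)

⊗-identityʳ : ∀ a → a ⊗ 𝟙 ≡ a
⊗-identityʳ = from-yes (∀F4? λ a → a ⊗ 𝟙 ≟ a)

⊗-≢𝟘 : ∀ a b → a ≢ 𝟘 → b ≢ 𝟘 → a ⊗ b ≢ 𝟘
⊗-≢𝟘 = from-yes (∀F4? λ a → ∀F4? λ b → ¬? (a ≟ 𝟘) →-dec (¬? (b ≟ 𝟘) →-dec ¬? (a ⊗ b ≟ 𝟘)))

conj-⊕ : ∀ a b → conj (a ⊕ b) ≡ conj a ⊕ conj b
conj-⊕ = from-yes (∀F4? λ a → ∀F4? λ b → conj (a ⊕ b) ≟ conj a ⊕ conj b)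

conj-⊗ : ∀ a b → conj (a ⊗ b) ≡ conj a ⊗ conj b
conj-⊗ = from-yes (∀F4? λ a → ∀F4? λ b → conj (a ⊗ b) ≟ conj a ⊗ conj b)

conj-≢𝟘 : ∀ a → a ≢ 𝟘 → conj a ≢ 𝟘
conj-≢𝟘 a a≢𝟘 = ⊗-≢𝟘 a a a≢𝟘 a≢𝟘

-- The multiplicative group has order 3, so a³ = 1 and conjugation doubles as inversion. All later
-- divisions by a scalar are written with `conj`.
conj-inverseˡ : ∀ a → a ≢ 𝟘 → conj a ⊗ a ≡ 𝟙
conj-inverseˡ = from-yes (∀F4? λ a → ¬? (a ≟ 𝟘) →-dec (conj a ⊗ a ≟ 𝟙))

-- The nontrivial additive character a ↦ (-1)^Tr(a).
χ : F4 → ℤ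
χ 𝟘  = 1ℤ
χ 𝟙  = 1ℤ
χ ω  = -1ℤ
χ ω² = -1ℤ

χ-⊕ : ∀ a b → χ (a ⊕ b) ≡ χ a * χ b
χ-⊕ = from-yes (∀F4? λ a → ∀F4? λ b → χ (a ⊕ b) ℤ.≟ χ a * χ b)

χ²≡1 : ∀ a → χ a * χ a ≡ 1ℤ
χ²≡1 = from-yes (∀F4? λ a → χ a * χ a ℤ.≟ 1ℤ)

-- Sums over F₄ᵐ

∑F4 : (F4 → ℤ) → ℤ
∑F4 f = f 𝟘 + f 𝟙 + f ω + f ω²

∑ : ∀ m → (V m → ℤ) → ℤ
∑ zero f = f []
∑ (suc m) f = ∑F4 λ a → ∑ m λ v → f (a ∷ v)

∑F4-cong : ∀ {f g} → (∀ a → f a ≡ g a) → ∑F4 f ≡ ∑F4 g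
∑F4-cong e rewrite e 𝟘 | e 𝟙 | e ω | e ω² = refl

∑F4-mono : ∀ {f g} → (∀ a → f a ≤ g a) → ∑F4 f ≤ ∑F4 g
∑F4-mono e = ℤ.+-mono-≤ (ℤ.+-mono-≤ (ℤ.+-mono-≤ (e 𝟘) (e 𝟙)) (e ω)) (e ω²)

∑F4-+ : ∀ f g → ∑F4 (λ a → f a + g a) ≡ ∑F4 f + ∑F4 g
∑F4-+ f g = lemma (f 𝟘) (f 𝟙) (f ω) (f ω²) (g 𝟘) (g 𝟙) (g ω) (g ω²)
  where
  lemma : ∀ a b c d a' b' c' d' →
    (a + a') + (b + b') + (c + c') + (d + d') ≡ (a + b + c + d) + (a' + b' + c' + d')
  lemma = solve-∀

∑F4-*ˡ : ∀ c f → ∑F4 (λ a → c * f a) ≡ c * ∑F4 f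
∑F4-*ˡ c f = lemma c (f 𝟘) (f 𝟙) (f ω) (f ω²)
  where
  lemma : ∀ x a b c d → x * a + x * b + x * c + x * d ≡ x * (a + b + c + d)
  lemma = solve-∀

∑F4-shift : ∀ f a → ∑F4 (λ b → f (b ⊕ a)) ≡ ∑F4 f
∑F4-shift f 𝟘 = refl
∑F4-shift f 𝟙 = lemma (f 𝟘) (f 𝟙) (f ω) (f ω²)
  where
  lemma : ∀ a b c d → b + a + d + c ≡ a + b + c + d
  lemma = solve-∀
∑F4-shift f ω = lemma (f 𝟘) (f 𝟙) (f ω) (f ω²)
  where
  lemma : ∀ a b c d → c + d + a + b ≡ a + b + c + d
  lemma = solve-∀
∑F4-shift f ω² = lemma (f 𝟘) (f 𝟙) (f ω) (f ω²)
  where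
  lemma : ∀ a b c d → d + c + b + a ≡ a + b + c + d
  lemma = solve-∀

∑-cong : ∀ m {f g : V m → ℤ} → (∀ v → f v ≡ g v) → ∑ m f ≡ ∑ m g
∑-cong zero e = e []
∑-cong (suc m) e = ∑F4-cong λ a → ∑-cong m λ v → e (a ∷ v)

∑-mono : ∀ m {f g : V m → ℤ} → (∀ v → f v ≤ g v) → ∑ m f ≤ ∑ m g
∑-mono zero e = e []
∑-mono (suc m) e = ∑F4-mono λ a → ∑-mono m λ v → e (a ∷ v)

∑-+ : ∀ m (f g : V m → ℤ) → ∑ m (λ v → f v + g v) ≡ ∑ m f + ∑ m g
∑-+ zero f g = refl
∑-+ (suc m) f g = trans (∑F4-cong λ a → ∑-+ m (f ∘ (a ∷_)) (g ∘ (a ∷_)))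
  (∑F4-+ (λ a → ∑ m (f ∘ (a ∷_))) (λ a → ∑ m (g ∘ (a ∷_))))

∑-*ˡ : ∀ m c (f : V m → ℤ) → ∑ m (λ v → c * f v) ≡ c * ∑ m f
∑-*ˡ zero c f = refl
∑-*ˡ (suc m) c f = trans (∑F4-cong λ a → ∑-*ˡ m c (f ∘ (a ∷_))) (∑F4-*ˡ c λ a → ∑ m (f ∘ (a ∷_)))

∑-*ʳ : ∀ m c (f : V m → ℤ) → ∑ m (λ v → f v * c) ≡ ∑ m f * c
∑-*ʳ m c f = trans (∑-cong m λ v → ℤ.*-comm (f v) c) (trans (∑-*ˡ m c f) (ℤ.*-comm c _))

∑-0 : ∀ m → ∑ m (λ _ → 0ℤ) ≡ 0ℤ
∑-0 m = ∑-*ˡ m 0ℤ (λ _ → 0ℤ)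

∑-1 : ∀ m → ∑ m (λ _ → 1ℤ) ≡ + (4 ℕ.^ m)
∑-1 zero = refl
∑-1 (suc m) rewrite ∑-1 m = trans (lemma (+ (4 ℕ.^ m))) (sym (ℤ.pos-* 4 (4 ℕ.^ m)))
  where
  lemma : ∀ x → x + x + x + x ≡ + 4 * x
  lemma = solve-∀

∑-shift : ∀ m f (w : V m) → ∑ m (λ v → f (v +v w)) ≡ ∑ m f
∑-shift zero f [] = refl
∑-shift (suc m) f (a ∷ w) =
  trans (∑F4-cong λ b → ∑-shift m (f ∘ ((b ⊕ a) ∷_)) w) (∑F4-shift (λ b → ∑ m (f ∘ (b ∷_))) a)

∑-swap : ∀ k m (f : V k → V m → ℤ) → ∑ k (λ u → ∑ m (f u)) ≡ ∑ m λ v → ∑ k λ u → f u v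
∑-swap zero m f = refl
∑-swap (suc k) m f = begin
  ∑F4 (λ a → ∑ k λ u → ∑ m (f (a ∷ u)))             ≡⟨ ∑F4-cong (λ a → ∑-swap k m (f ∘ (a ∷_))) ⟩
  ∑F4 (λ a → ∑ m (g a))                              ≡⟨ cong (λ s → s + ∑ m (g ω) + ∑ m (g ω²)) (∑-+ m (g 𝟘) (g 𝟙)) ⟨
  ∑ m (λ v → g 𝟘 v + g 𝟙 v) + ∑ m (g ω) + ∑ m (g ω²) ≡⟨ cong (_+ ∑ m (g ω²)) (∑-+ m _ (g ω)) ⟨
  ∑ m (λ v → g 𝟘 v + g 𝟙 v + g ω v) + ∑ m (g ω²)     ≡⟨ ∑-+ m _ (g ω²) ⟨
  ∑ m (λ v → ∑F4 λ a → g a v)                        ∎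
  where
  open ≡-Reasoning
  g : F4 → V m → ℤ
  g a v = ∑ k λ u → f (a ∷ u) v

-- Kronecker delta on F₄ᵐ

δF4 : F4 → F4 → ℤ
δF4 𝟘  𝟘  = 1ℤ
δF4 𝟙  𝟙  = 1ℤ
δF4 ω  ω  = 1ℤ
δF4 ω² ω² = 1ℤ
δF4 _  _  = 0ℤ

δ : ∀ {m} → V m → V m → ℤ
δ [] [] = 1ℤ
δ (a ∷ u) (b ∷ v) = δF4 a b * δ u v

δF4-refl : ∀ a → δF4 a a ≡ 1ℤ
δF4-refl = from-yes (∀F4? λ a → δF4 a a ℤ.≟ 1ℤ)

δF4-≢ : ∀ a b → a ≢ b → δF4 a b ≡ 0ℤ
δF4-≢ = from-yes (∀F4? λ a → ∀F4? λ b → ¬? (a ≟ b) →-dec (δF4 a b ℤ.≟ 0ℤ))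

δ-refl : ∀ {m} (u : V m) → δ u u ≡ 1ℤ
δ-refl [] = refl
δ-refl (a ∷ u) rewrite δF4-refl a | δ-refl u = refl

δ-≢ : ∀ {m} (u v : V m) → u ≢ v → δ u v ≡ 0ℤ
δ-≢ [] [] u≢v = contradiction refl u≢v
δ-≢ (a ∷ u) (b ∷ v) u≢v with a ≟ b
... | no a≢b rewrite δF4-≢ a b a≢b = refl
... | yes refl rewrite δ-≢ u v (u≢v ∘ cong (a ∷_)) = ℤ.*-zeroʳ (δF4 a a)

0≤δ : ∀ {m} (u v : V m) → 0ℤ ≤ δ u v
0≤δ u v with u ≟ᵛ v
... | yes refl rewrite δ-refl u = +≤+ ℕ.z≤n
... | no u≢v rewrite δ-≢ u v u≢v = ℤ.≤-refl

δ-≤ : ∀ {k m} {u u' : V k} {v v' : V m} → (u ≡ u' → v ≡ v') → δ u u' ≤ δ v v'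
δ-≤ {u = u} {u'} {v} {v'} imp with u ≟ᵛ u'
... | no u≢u' rewrite δ-≢ u u' u≢u' = 0≤δ v v'
... | yes refl rewrite δ-refl u | imp refl | δ-refl v' = ℤ.≤-refl

∑-δ : ∀ m (u : V m) (f : V m → ℤ) → ∑ m (λ v → δ u v * f v) ≡ f u
∑-δ zero [] f = ℤ.*-identityˡ (f [])
∑-δ (suc m) (a ∷ u) f = trans (∑F4-cong term) (pick a)
  where
  open ≡-Reasoning
  g : F4 → ℤ
  g b = f (b ∷ u)
  term : ∀ b → ∑ m (λ v → δF4 a b * δ u v * f (b ∷ v)) ≡ δF4 a b * g b
  term b = begin
    ∑ m (λ v → δF4 a b * δ u v * f (b ∷ v))   ≡⟨ ∑-cong m (λ v → ℤ.*-assoc (δF4 a b) (δ u v) _) ⟩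
    ∑ m (λ v → δF4 a b * (δ u v * f (b ∷ v))) ≡⟨ ∑-*ˡ m (δF4 a b) _ ⟩
    δF4 a b * ∑ m (λ v → δ u v * f (b ∷ v))   ≡⟨ cong (δF4 a b *_) (∑-δ m u (f ∘ (b ∷_))) ⟩
    δF4 a b * g b                             ∎
  pick : ∀ a → ∑F4 (λ b → δF4 a b * g b) ≡ g a
  pick 𝟘 = lemma (g 𝟘) (g 𝟙) (g ω) (g ω²)
    where
    lemma : ∀ a b c d → 1ℤ * a + 0ℤ * b + 0ℤ * c + 0ℤ * d ≡ a
    lemma = solve-∀
  pick 𝟙 = lemma (g 𝟘) (g 𝟙) (g ω) (g ω²)
    where
    lemma : ∀ a b c d → 0ℤ * a + 1ℤ * b + 0ℤ * c + 0ℤ * d ≡ b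
    lemma = solve-∀
  pick ω = lemma (g 𝟘) (g 𝟙) (g ω) (g ω²)
    where
    lemma : ∀ a b c d → 0ℤ * a + 0ℤ * b + 1ℤ * c + 0ℤ * d ≡ c
    lemma = solve-∀
  pick ω² = lemma (g 𝟘) (g 𝟙) (g ω) (g ω²)
    where
    lemma : ∀ a b c d → 0ℤ * a + 0ℤ * b + 0ℤ * c + 1ℤ * d ≡ d
    lemma = solve-∀

∑-δ-1 : ∀ m (u : V m) → ∑ m (δ u) ≡ 1ℤ
∑-δ-1 m u = trans (∑-cong m λ v → sym (ℤ.*-identityʳ (δ u v))) (∑-δ m u λ _ → 1ℤ)

-- Sums over lists, compared with sums over the whole space

∑L : ∀ {A : Set} → List A → (A → ℤ) → ℤ
∑L [] f = 0ℤ
∑L (x ∷ xs) f = f x + ∑L xs f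

∑-∑L : ∀ m {A : Set} (xs : List A) (f : A → V m → ℤ) →
  ∑ m (λ v → ∑L xs λ x → f x v) ≡ ∑L xs λ x → ∑ m (f x)
∑-∑L m [] f = ∑-0 m
∑-∑L m (x ∷ xs) f = trans (∑-+ m (f x) _) (cong (λ s → ∑ m (f x) + s) (∑-∑L m xs f))

∑L-cong : ∀ {A : Set} (xs : List A) {f g : A → ℤ} → (∀ x → f x ≡ g x) → ∑L xs f ≡ ∑L xs g
∑L-cong [] e = refl
∑L-cong (x ∷ xs) e = cong₂ _+_ (e x) (∑L-cong xs e)

∑L-congᴬ : ∀ {A : Set} {xs : List A} {f g : A → ℤ} → All (λ x → f x ≡ g x) xs → ∑L xs f ≡ ∑L xs g
∑L-congᴬ [] = refl
∑L-congᴬ (e ∷ es) = cong₂ _+_ e (∑L-congᴬ es)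

∑L-*ʳ : ∀ {A : Set} (xs : List A) c f → ∑L xs (λ x → f x * c) ≡ ∑L xs f * c
∑L-*ʳ [] c f = refl
∑L-*ʳ (x ∷ xs) c f = trans (cong (λ s → f x * c + s) (∑L-*ʳ xs c f)) (sym (ℤ.*-distribʳ-+ c (f x) (∑L xs f)))

∑L-const : ∀ {A : Set} (xs : List A) c → ∑L xs (λ _ → c) ≡ + length xs * c
∑L-const [] c = refl
∑L-const (x ∷ xs) c = trans (cong (λ s → c + s) (∑L-const xs c)) (sym (ℤ.suc-* (+ length xs) c))

∑L-δ-∉ : ∀ {m} {x : V m} {xs} → All (x ≢_) xs → ∑L xs (λ y → δ y x) ≡ 0ℤ
∑L-δ-∉ [] = refl
∑L-δ-∉ {x = x} {y ∷ _} (x≢y ∷ x∉xs) rewrite δ-≢ y x (x≢y ∘ sym) | ∑L-δ-∉ x∉xs = refl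

∑L-δ-≤ : ∀ {m} {xs : List (V m)} → AllPairs _≢_ xs → ∀ v → ∑L xs (λ x → δ x v) ≤ 1ℤ
∑L-δ-≤ [] v = +≤+ ℕ.z≤n
∑L-δ-≤ {xs = x ∷ xs} (x∉xs ∷ uniq) v with x ≟ᵛ v
... | no x≢v rewrite δ-≢ x v x≢v | ℤ.+-identityˡ (∑L xs (λ x → δ x v)) = ∑L-δ-≤ uniq v
... | yes refl rewrite δ-refl x | ∑L-δ-∉ x∉xs = ℤ.≤-refl

-- Writing each `f x` as a sum against `δ` and exchanging the sums gives every `f v` the
-- multiplicity of `v` in `xs` as weight. Distinctness keeps the weight at most 1, and
-- non-negativity of `f` allows it to be raised to 1.
∑L≤∑ : ∀ m {xs : List (V m)} {f : V m → ℤ} → AllPairs _≢_ xs → (∀ v → 0ℤ ≤ f v) → ∑L xs f ≤ ∑ m f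
∑L≤∑ m {xs} {f} uniq 0≤f = begin
  ∑L xs f                                   ≡⟨ ∑L-cong xs (λ x → ∑-δ m x f) ⟨
  ∑L xs (λ x → ∑ m λ v → δ x v * f v)       ≡⟨ ∑-∑L m xs _ ⟨
  ∑ m (λ v → ∑L xs λ x → δ x v * f v)       ≡⟨ ∑-cong m (λ v → ∑L-*ʳ xs (f v) (λ x → δ x v)) ⟩
  ∑ m (λ v → ∑L xs (λ x → δ x v) * f v)     ≤⟨ ∑-mono m bound ⟩
  ∑ m f                                     ∎
  where
  open ℤ.≤-Reasoning
  bound : ∀ v → ∑L xs (λ x → δ x v) * f v ≤ f v
  bound v = subst (∑L xs (λ x → δ x v) * f v ≤_) (ℤ.*-identityˡ (f v))
    (ℤ.*-monoʳ-≤-nonNeg (f v) {{nonNegative (0≤f v)}} (∑L-δ-≤ uniq v))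

4^-cancel-≤ : ∀ {k m} → 4 ℕ.^ k ℕ.≤ 4 ℕ.^ m → k ℕ.≤ m
4^-cancel-≤ {k} {m} le with k ℕ.≤? m
... | yes k≤m = k≤m
... | no k≰m = contradiction le (ℕ.<⇒≱ (ℕ.^-monoʳ-< 4 (ℕ.s≤s (ℕ.s≤s ℕ.z≤n)) (ℕ.≰⇒> k≰m)))

-- Counting the pairs (u , f u): each v is hit at most once, by g v.
retraction⇒≤ : ∀ {k m} (f : V k → V m) (g : V m → V k) → (∀ u → g (f u) ≡ u) → k ℕ.≤ m
retraction⇒≤ {k} {m} f g gf = 4^-cancel-≤ (ℤ.drop‿+≤+ (begin
  + (4 ℕ.^ k)                      ≡⟨ ∑-1 k ⟨
  ∑ k (λ _ → 1ℤ)                   ≡⟨ ∑-cong k (λ u → ∑-δ-1 m (f u)) ⟨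
  ∑ k (λ u → ∑ m (δ (f u)))        ≡⟨ ∑-swap k m _ ⟩
  ∑ m (λ v → ∑ k λ u → δ (f u) v)  ≤⟨ ∑-mono m (λ v → ∑-mono k λ u → δ-≤ {u = f u} {v} {g v} λ { refl → gf u }) ⟩
  ∑ m (λ v → ∑ k (δ (g v)))        ≡⟨ ∑-cong m (λ v → ∑-δ-1 k (g v)) ⟩
  ∑ m (λ _ → 1ℤ)                   ≡⟨ ∑-1 m ⟩
  + (4 ℕ.^ m)                      ∎))
  where open ℤ.≤-Reasoning

-- Vectors and points

+v-self : ∀ {m} (v : V m) → v +v v ≡ 0v
+v-self [] = refl
+v-self (a ∷ v) = cong₂ _∷_ (⊕-self a) (+v-self v)

+v-cancel : ∀ {m} (u v : V m) → u +v v ≡ 0v → u ≡ v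
+v-cancel [] [] _ = refl
+v-cancel (a ∷ u) (b ∷ v) e =
  cong₂ _∷_ (⊕-cancel a b (Vec.∷-injectiveˡ e)) (+v-cancel u v (Vec.∷-injectiveʳ e))

𝟘·v : ∀ {m} (v : V m) → 𝟘 ·v v ≡ 0v
𝟘·v v = Vec.map-const v 𝟘

𝟙·v : ∀ {m} (v : V m) → 𝟙 ·v v ≡ v
𝟙·v = Vec.map-id

·v-assoc : ∀ {m} a b (v : V m) → a ·v (b ·v v) ≡ (a ⊗ b) ·v v
·v-assoc a b v = trans (sym (Vec.map-∘ (a ⊗_) (b ⊗_) v)) (Vec.map-cong (λ c → sym (⊗-assoc a b c)) v)

·v-distrib-+v : ∀ {m} a (u v : V m) → a ·v (u +v v) ≡ (a ·v u) +v (a ·v v)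
·v-distrib-+v a [] [] = refl
·v-distrib-+v a (b ∷ u) (c ∷ v) = cong₂ _∷_ (⊗-distribˡ-⊕ a b c) (·v-distrib-+v a u v)
  where
  ⊗-distribˡ-⊕ : ∀ a b c → a ⊗ (b ⊕ c) ≡ a ⊗ b ⊕ a ⊗ c
  ⊗-distribˡ-⊕ = from-yes (∀F4? λ a → ∀F4? λ b → ∀F4? λ c → a ⊗ (b ⊕ c) ≟ a ⊗ b ⊕ a ⊗ c)

·v-inverse : ∀ {m} a (u v : V m) → a ≢ 𝟘 → u ≡ a ·v v → conj a ·v u ≡ v
·v-inverse a u v a≢𝟘 refl =
  trans (·v-assoc (conj a) a v) (trans (cong (_·v v) (conj-inverseˡ a a≢𝟘)) (𝟙·v v))

SamePoint-sym : ∀ {m} → Symmetric (SamePoint {m})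
SamePoint-sym {_} {x} {y} (c , c≢𝟘 , e) = conj c , conj-≢𝟘 c c≢𝟘 , sym (·v-inverse c y x c≢𝟘 e)

SamePoint-≡ : ∀ {m} a b (x y : V m) → a ≢ 𝟘 → b ≢ 𝟘 → a ·v x ≡ b ·v y → SamePoint x y
SamePoint-≡ a b x y a≢𝟘 b≢𝟘 e =
  conj b ⊗ a , ⊗-≢𝟘 (conj b) a (conj-≢𝟘 b b≢𝟘) a≢𝟘 ,
  trans (sym (·v-inverse b (a ·v x) y b≢𝟘 e)) (·v-assoc (conj b) a x)

AllPairs-mapᴬ : ∀ {A : Set} {P : A → Set} {R S : A → A → Set} →
  (∀ {x y} → P x → P y → R x y → S x y) → ∀ {xs} → All P xs → AllPairs R xs → AllPairs S xs
AllPairs-mapᴬ f [] [] = []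
AllPairs-mapᴬ f (p ∷ ps) (rs ∷ rss) =
  All.zipWith (λ (q , r) → f p q r) (ps , rs) ∷ AllPairs-mapᴬ f ps rss

AllPairs⇒All² : ∀ {A : Set} {R : A → A → Set} → Symmetric R → ∀ {xs} →
  All (λ x → R x x) xs → AllPairs R xs → All (λ x → All (R x) xs) xs
AllPairs⇒All² sy [] [] = []
AllPairs⇒All² sy (r ∷ rs) (p ∷ ps) =
  (r ∷ p) ∷ All.zipWith (λ (xy , ys) → sy xy ∷ ys) (p , AllPairs⇒All² sy rs ps)

-- The three nonzero vectors on each point of a list

orbits : ∀ {m} → List (V m) → List (V m)
orbits [] = []
orbits (x ∷ xs) = (𝟙 ·v x) ∷ (ω ·v x) ∷ (ω² ·v x) ∷ orbits xs

length-orbits : ∀ {m} (xs : List (V m)) → length (orbits xs) ≡ 3 ℕ.* length xs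
length-orbits [] = refl
length-orbits (x ∷ xs) = trans (cong (λ n → suc (suc (suc n))) (length-orbits xs)) (sym (ℕ.*-suc 3 (length xs)))

-- One closure condition covers all three multiples because `orbits` lists `𝟙 ·v x` in place of `x`.
All-orbits : ∀ {m} {P Q : V m → Set} → (∀ a x → a ≢ 𝟘 → P x → Q (a ·v x)) →
  ∀ {xs} → All P xs → All Q (orbits xs)
All-orbits f [] = []
All-orbits f (p ∷ ps) = f 𝟙 _ (λ ()) p ∷ f ω _ (λ ()) p ∷ f ω² _ (λ ()) p ∷ All-orbits f ps

∈-orbits : ∀ {m} {v : V m} {xs} → Any (SamePoint v) xs → v ∈ orbits xs
∈-orbits {v = v} {x ∷ xs} (here same) with SamePoint-sym same
... | 𝟘 , c≢𝟘 , _ = contradiction refl c≢𝟘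
... | 𝟙 , _ , e = here e
... | ω , _ , e = there (here e)
... | ω² , _ , e = there (there (here e))
∈-orbits (there p) = there (there (there (∈-orbits p)))

0≤∑L-δ : ∀ {m} (v : V m) xs → 0ℤ ≤ ∑L xs (λ x → δ x v)
0≤∑L-δ v [] = ℤ.≤-refl
0≤∑L-δ v (x ∷ xs) = ℤ.+-mono-≤ (0≤δ x v) (0≤∑L-δ v xs)

1≤∑L-δ : ∀ {m} {v : V m} {xs} → v ∈ xs → 1ℤ ≤ ∑L xs (λ x → δ x v)
1≤∑L-δ {v = v} {x ∷ xs} (here refl) rewrite δ-refl v = ℤ.+-monoʳ-≤ 1ℤ (0≤∑L-δ v xs)
1≤∑L-δ {v = v} {x ∷ xs} (there p) = ℤ.+-mono-≤ (0≤δ x v) (1≤∑L-δ p)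

-- Hermitian forms and adjacency

module Hermitian {m : ℕ} (H : HermitianForm m) where
  open HermitianForm H
  open NU H

  h-0ˡ : ∀ y → h 0v y ≡ 𝟘
  h-0ˡ y = trans (cong (λ x → h x y) (sym (𝟘·v 0v))) (homog 𝟘 0v y)

  h-0ʳ : ∀ x → h x 0v ≡ 𝟘
  h-0ʳ x = trans (hermit 0v x) (cong conj (h-0ˡ x))

  h-+ʳ : ∀ x y z → h x (y +v z) ≡ h x y ⊕ h x z
  h-+ʳ x y z = begin
    h x (y +v z)                ≡⟨ hermit (y +v z) x ⟩
    conj (h (y +v z) x)         ≡⟨ cong conj (additive y z x) ⟩
    conj (h y x ⊕ h z x)        ≡⟨ conj-⊕ (h y x) (h z x) ⟩
    conj (h y x) ⊕ conj (h z x) ≡⟨ cong₂ _⊕_ (hermit y x) (hermit z x) ⟨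
    h x y ⊕ h x z               ∎
    where open ≡-Reasoning

  h-·ʳ : ∀ a x y → h x (a ·v y) ≡ conj a ⊗ h x y
  h-·ʳ a x y = begin
    h x (a ·v y)           ≡⟨ hermit (a ·v y) x ⟩
    conj (h (a ·v y) x)    ≡⟨ cong conj (homog a y x) ⟩
    conj (a ⊗ h y x)       ≡⟨ conj-⊗ a (h y x) ⟩
    conj a ⊗ conj (h y x)  ≡⟨ cong (conj a ⊗_) (hermit y x) ⟨
    conj a ⊗ h x y         ∎
    where open ≡-Reasoning

  h-sym-𝟘 : ∀ {x y} → h x y ≡ 𝟘 → h y x ≡ 𝟘
  h-sym-𝟘 {x} {y} e = trans (hermit x y) (cong conj e)

  h-sym-≢𝟘 : ∀ {x y} → h x y ≢ 𝟘 → h y x ≢ 𝟘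
  h-sym-≢𝟘 ne = ne ∘ h-sym-𝟘

  norm-≢𝟘 : ∀ x → h x x ≢ 𝟘 → h x x ≡ 𝟙
  norm-≢𝟘 x = fixed (h x x) (hermit x x)
    where
    fixed : ∀ a → a ≡ conj a → a ≢ 𝟘 → a ≡ 𝟙
    fixed = from-yes (∀F4? λ a → (a ≟ conj a) →-dec (¬? (a ≟ 𝟘) →-dec (a ≟ 𝟙)))

  norm-+ : ∀ x y → h (x +v y) (x +v y) ≡ h x x ⊕ h y y ⊕ (h x y ⊕ conj (h x y))
  norm-+ x y = begin
    h (x +v y) (x +v y)                                   ≡⟨ additive x y (x +v y) ⟩
    h x (x +v y) ⊕ h y (x +v y)                           ≡⟨ cong₂ _⊕_ (h-+ʳ x x y) (h-+ʳ y x y) ⟩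
    (h x x ⊕ h x y) ⊕ (h y x ⊕ h y y)                     ≡⟨ cong (λ t → (h x x ⊕ h x y) ⊕ (t ⊕ h y y)) (hermit x y) ⟩
    (h x x ⊕ h x y) ⊕ (conj (h x y) ⊕ h y y)              ≡⟨ lemma (h x x) (h y y) (h x y) ⟩
    h x x ⊕ h y y ⊕ (h x y ⊕ conj (h x y))                ∎
    where
    open ≡-Reasoning
    lemma : ∀ p q t → (p ⊕ t) ⊕ (conj t ⊕ q) ≡ p ⊕ q ⊕ (t ⊕ conj t)
    lemma = from-yes (∀F4? λ p → ∀F4? λ q → ∀F4? λ t → (p ⊕ t) ⊕ (conj t ⊕ q) ≟ p ⊕ q ⊕ (t ⊕ conj t))

  norm-· : ∀ a x → h (a ·v x) (a ·v x) ≡ a ⊗ (conj a ⊗ h x x)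
  norm-· a x = trans (homog a x (a ·v x)) (cong (a ⊗_) (h-·ʳ a x x))

  -- On a line spanned by x, y of norm 1 with t = h x y ≠ 0, the only isotropic point is ⟨t̄ x + y⟩.
  h≢𝟘⇒Adj : ∀ {x y} → h x x ≡ 𝟙 → h y y ≡ 𝟙 → ¬ SamePoint x y → h x y ≢ 𝟘 → Adj x y
  h≢𝟘⇒Adj {x} {y} hx hy diff t≢𝟘 =
    diff , z , (conj t , 𝟙 , refl) , z≢0 , trans (norm (conj t) 𝟙) (iso t t≢𝟘) , unique
    where
    open ≡-Reasoning
    t = h x y
    N : F4 → F4 → F4 → F4
    N a b t = a ⊗ (conj a ⊗ 𝟙) ⊕ b ⊗ (conj b ⊗ 𝟙) ⊕ (a ⊗ (conj b ⊗ t) ⊕ conj (a ⊗ (conj b ⊗ t)))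
    norm : ∀ a b → h ((a ·v x) +v (b ·v y)) ((a ·v x) +v (b ·v y)) ≡ N a b t
    norm a b rewrite norm-+ (a ·v x) (b ·v y) | norm-· a x | norm-· b y
      | homog a x (b ·v y) | h-·ʳ b x y | hx | hy = refl
    -- As t·t̄ = 1, `N a b t` is the norm of a + b·t̄. The form has rank one on the line, and its
    -- zeros are a = b·t̄.
    iso : ∀ t → t ≢ 𝟘 → N (conj t) 𝟙 t ≡ 𝟘
    iso = from-yes (∀F4? λ t → ¬? (t ≟ 𝟘) →-dec (N (conj t) 𝟙 t ≟ 𝟘))
    only : ∀ a b t → t ≢ 𝟘 → N a b t ≡ 𝟘 → a ≡ b ⊗ conj t
    only = from-yes (∀F4? λ a → ∀F4? λ b → ∀F4? λ t →
      ¬? (t ≟ 𝟘) →-dec ((N a b t ≟ 𝟘) →-dec (a ≟ b ⊗ conj t)))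
    z = (conj t ·v x) +v (𝟙 ·v y)
    z≢0 : z ≢ 0v
    z≢0 e = diff (conj t , conj-≢𝟘 t t≢𝟘 ,
      trans (sym (𝟙·v y)) (sym (+v-cancel (conj t ·v x) (𝟙 ·v y) e)))
    multiple : ∀ a b → N a b t ≡ 𝟘 → (a ·v x) +v (b ·v y) ≡ b ·v z
    multiple a b e = begin
      (a ·v x) +v (b ·v y)                      ≡⟨ cong₂ (λ a b → (a ·v x) +v (b ·v y)) (only a b t t≢𝟘 e) (sym (⊗-identityʳ b)) ⟩
      ((b ⊗ conj t) ·v x) +v ((b ⊗ 𝟙) ·v y)      ≡⟨ cong₂ _+v_ (·v-assoc b (conj t) x) (·v-assoc b 𝟙 y) ⟨
      (b ·v (conj t ·v x)) +v (b ·v (𝟙 ·v y))    ≡⟨ ·v-distrib-+v b (conj t ·v x) (𝟙 ·v y) ⟨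
      b ·v z                                    ∎
    unique : ∀ z' → InSpan x y z' → z' ≢ 0v → Isotropic z' → SamePoint z z'
    unique z' (a , b , refl) z'≢0 e = b , b≢𝟘 , mult
      where
      mult = multiple a b (trans (sym (norm a b)) e)
      b≢𝟘 : b ≢ 𝟘
      b≢𝟘 b≡𝟘 = z'≢0 (trans mult (trans (cong (_·v z) b≡𝟘) (𝟘·v z)))

  -- If x ⊥ y then both x + y and ωx + y are isotropic.
  Adj⇒h≢𝟘 : ∀ {x y} → h x x ≡ 𝟙 → h y y ≡ 𝟙 → Adj x y → h x y ≢ 𝟘
  Adj⇒h≢𝟘 {x} {y} hx hy (_ , z , _ , _ , _ , unique) h≡𝟘 =
    -- Were both vectors multiples of `z`, the product with x + y would force h z x = h z y, while
    -- the product with ωx + y would force h z x = ω·h z y with both nonzero.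
    scalars c d (h z x) (h z y)
      (trans (via eqc x) (ax 𝟙)) (trans (via eqc y) (ay 𝟙))
      (trans (via eqd x) (ax ω)) (trans (via eqd y) (ay ω))
    where
    w : F4 → V m
    w a = (a ·v x) +v (𝟙 ·v y)
    ax : ∀ a → h (w a) x ≡ a
    ax a rewrite additive (a ·v x) (𝟙 ·v y) x | homog a x x | homog 𝟙 y x | hx | h-sym-𝟘 h≡𝟘
      | ⊗-identityʳ a = ⊕-identityʳ a
    ay : ∀ a → h (w a) y ≡ 𝟙
    ay a rewrite additive (a ·v x) (𝟙 ·v y) y | homog a x y | homog 𝟙 y y | hy | h≡𝟘
      | ⊗-zeroʳ a = refl
    w≢0 : ∀ a → w a ≢ 0v
    w≢0 a e with trans (sym (ay a)) (trans (cong (λ v → h v y) e) (h-0ˡ y))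
    ... | ()
    isotropic : ∀ a → a ≢ 𝟘 → Isotropic (w a)
    isotropic a a≢𝟘 rewrite norm-+ (a ·v x) (𝟙 ·v y) | norm-· a x | norm-· 𝟙 y
      | homog a x (𝟙 ·v y) | h-·ʳ 𝟙 x y | hx | hy | h≡𝟘 = lemma a a≢𝟘
      where
      lemma : ∀ a → a ≢ 𝟘 → a ⊗ (conj a ⊗ 𝟙) ⊕ 𝟙 ⊕ (a ⊗ 𝟘 ⊕ conj (a ⊗ 𝟘)) ≡ 𝟘
      lemma = from-yes (∀F4? λ a → ¬? (a ≟ 𝟘) →-dec (a ⊗ (conj a ⊗ 𝟙) ⊕ 𝟙 ⊕ (a ⊗ 𝟘 ⊕ conj (a ⊗ 𝟘)) ≟ 𝟘))
    same : ∀ a → a ≢ 𝟘 → SamePoint z (w a)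
    same a a≢𝟘 = unique (w a) (a , 𝟙 , refl) (w≢0 a) (isotropic a a≢𝟘)
    c = proj₁ (same 𝟙 λ ())
    d = proj₁ (same ω λ ())
    eqc = proj₂ (proj₂ (same 𝟙 λ ()))
    eqd = proj₂ (proj₂ (same ω λ ()))
    via : ∀ {b v} → v ≡ b ·v z → ∀ u → b ⊗ h z u ≡ h v u
    via {b} refl u = sym (homog b z u)
    scalars : ∀ c d p q → c ⊗ p ≡ 𝟙 → c ⊗ q ≡ 𝟙 → d ⊗ p ≡ ω → d ⊗ q ≢ 𝟙
    scalars = from-yes (∀F4? λ c → ∀F4? λ d → ∀F4? λ p → ∀F4? λ q →
      (c ⊗ p ≟ 𝟙) →-dec ((c ⊗ q ≟ 𝟙) →-dec ((d ⊗ p ≟ ω) →-dec ¬? (d ⊗ q ≟ 𝟙))))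

  vertices⇒norm-𝟙 : ∀ {L} → All IsVertex L → All (λ x → h x x ≡ 𝟙) L
  vertices⇒norm-𝟙 = All.map λ {x} (_ , ne) → norm-≢𝟘 x ne

  -- Multiples of one `x` are told apart by their product with `x`, which returns the coefficient
  -- because `x` has norm 1. An equality between multiples of different entries would identify their
  -- points.
  orbits-unique : ∀ {L} → All (λ x → h x x ≡ 𝟙) L → AllPairs (λ x y → ¬ SamePoint x y) L →
    AllPairs _≢_ (orbits L)
  orbits-unique [] [] = []
  orbits-unique {x ∷ xs} (hx ∷ hs) (new ∷ diff) =
    (apart 𝟙 ω (λ ()) ∷ apart 𝟙 ω² (λ ()) ∷ far 𝟙 λ ()) ∷
    (apart ω ω² (λ ()) ∷ far ω λ ()) ∷
    far ω² (λ ()) ∷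
    orbits-unique hs diff
    where
    coefficient : ∀ a → h (a ·v x) x ≡ a
    coefficient a = trans (homog a x x) (trans (cong (a ⊗_) hx) (⊗-identityʳ a))
    apart : ∀ a b → a ≢ b → a ·v x ≢ b ·v x
    apart a b a≢b e = a≢b (trans (sym (coefficient a)) (trans (cong (λ v → h v x) e) (coefficient b)))
    far : ∀ a → a ≢ 𝟘 → All ((a ·v x) ≢_) (orbits xs)
    far a a≢𝟘 = All-orbits (λ b y b≢𝟘 ¬same e → ¬same (SamePoint-≡ a b x y a≢𝟘 b≢𝟘 e)) new

  scaled-≢0 : ∀ {x} a → a ≢ 𝟘 → h x x ≡ 𝟙 → a ·v x ≢ 0v
  scaled-≢0 {x} a a≢𝟘 hx ax≡0 = a≢𝟘 (begin
    a              ≡⟨ ⊗-identityʳ a ⟨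
    a ⊗ 𝟙          ≡⟨ cong (a ⊗_) hx ⟨
    a ⊗ h x x      ≡⟨ homog a x x ⟨
    h (a ·v x) x   ≡⟨ cong (λ v → h v x) ax≡0 ⟩
    h 0v x         ≡⟨ h-0ˡ x ⟩
    𝟘              ∎)
    where open ≡-Reasoning

  -- The diagonal is covered since norm 1 is nonzero. The Fourier transform at a clique vector sums
  -- over the whole clique, that vector's own point included.
  clique⇒All² : ∀ {L} → All (λ x → h x x ≡ 𝟙) L → AllPairs Adj L → All (λ x → All (λ y → h x y ≢ 𝟘) L) L
  clique⇒All² hs as =
    AllPairs⇒All² h-sym-≢𝟘 (All.map (λ hx e → contradiction (trans (sym hx) e) λ ()) hs)
      (AllPairs-mapᴬ Adj⇒h≢𝟘 hs as)

-- Character sums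

x≡-x⇒x≡0 : ∀ x → x ≡ x * -1ℤ → x ≡ 0ℤ
x≡-x⇒x≡0 (+ zero) _ = refl

0≤i*i : ∀ i → 0ℤ ≤ i * i
0≤i*i (+ n) rewrite sym (ℤ.pos-* n n) = +≤+ ℕ.z≤n
0≤i*i -[1+ n ] = +≤+ ℕ.z≤n

i*i≡n*n⇒i≤n : ∀ i n → i * i ≡ + n * + n → i ≤ + n
i*i≡n*n⇒i≤n -[1+ _ ] n _ = -≤+
i*i≡n*n⇒i≤n (+ k) n e with k ℕ.≤? n
... | yes k≤n = +≤+ k≤n
... | no k≰n = contradiction
  (ℤ.+-injective (trans (ℤ.pos-* k k) (trans e (sym (ℤ.pos-* n n)))))
  (ℕ.<⇒≢ (ℕ.*-mono-< (ℕ.≰⇒> k≰n) (ℕ.≰⇒> k≰n)) ∘ sym)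

4^n≡2^n*2^n : ∀ n → 4 ℕ.^ n ≡ 2 ℕ.^ n ℕ.* 2 ℕ.^ n
4^n≡2^n*2^n n = trans (ℕ.^-*-assoc 2 2 n) (trans (ℕ.^-distribˡ-+-* 2 n (n ℕ.+ 0))
  (cong (λ k → 2 ℕ.^ n ℕ.* 2 ℕ.^ k) (ℕ.+-identityʳ n)))

module Nondeg {m : ℕ} (H : HermitianForm m) (nondeg : Nondegenerate H) where
  open HermitianForm H
  open NU H
  open Hermitian H

  h-surjective : ∀ {s} → s ≢ 0v → ∀ c → ∃ λ u → h u s ≡ c
  h-surjective {s} s≢0 c with any-Vec? any-F4? m (λ y → ¬? (h s y ≟ 𝟘))
  ... | no ¬ex = contradiction (nondeg s λ y → decidable-stable (h s y ≟ 𝟘) λ ne → ¬ex (y , ne)) s≢0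
  ... | yes (y , ne) = (c ⊗ conj t) ·v y , (begin
    h ((c ⊗ conj t) ·v y) s ≡⟨ homog (c ⊗ conj t) y s ⟩
    (c ⊗ conj t) ⊗ t        ≡⟨ ⊗-assoc c (conj t) t ⟩
    c ⊗ (conj t ⊗ t)        ≡⟨ cong (c ⊗_) (conj-inverseˡ t (h-sym-≢𝟘 ne)) ⟩
    c ⊗ 𝟙                   ≡⟨ ⊗-identityʳ c ⟩
    c                       ∎)
    where
    open ≡-Reasoning
    t = h y s

  -- Translation by some w with h w s = ω leaves the sum unchanged and also multiplies it by χ ω =
  -- -1.
  ∑χ≡0 : ∀ {s} → s ≢ 0v → ∑ m (λ u → χ (h u s)) ≡ 0ℤ
  ∑χ≡0 {s} s≢0 with h-surjective s≢0 ω
  ... | w , hw≡ω = x≡-x⇒x≡0 _ (begin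
    ∑ m (λ u → χ (h u s))              ≡⟨ ∑-shift m (λ u → χ (h u s)) w ⟨
    ∑ m (λ u → χ (h (u +v w) s))       ≡⟨ ∑-cong m (λ u → cong χ (additive u w s)) ⟩
    ∑ m (λ u → χ (h u s ⊕ h w s))      ≡⟨ ∑-cong m (λ u → χ-⊕ (h u s) (h w s)) ⟩
    ∑ m (λ u → χ (h u s) * χ (h w s))  ≡⟨ ∑-*ʳ m (χ (h w s)) (λ u → χ (h u s)) ⟩
    ∑ m (λ u → χ (h u s)) * χ (h w s)  ≡⟨ cong (λ c → ∑ m (λ u → χ (h u s)) * χ c) hw≡ω ⟩
    ∑ m (λ u → χ (h u s)) * -1ℤ        ∎)
    where open ≡-Reasoning

  ∑χ≡δ : ∀ s → ∑ m (λ u → χ (h u s)) ≡ δ 0v s * + (4 ℕ.^ m)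
  ∑χ≡δ s with 0v ≟ᵛ s
  ... | no 0≢s rewrite δ-≢ 0v s 0≢s = ∑χ≡0 (0≢s ∘ sym)
  ... | yes refl = begin
    ∑ m (λ u → χ (h u 0v))       ≡⟨ ∑-cong m (λ u → cong χ (h-0ʳ u)) ⟩
    ∑ m (λ _ → 1ℤ)               ≡⟨ ∑-1 m ⟩
    + (4 ℕ.^ m)                  ≡⟨ ℤ.*-identityˡ (+ (4 ℕ.^ m)) ⟨
    1ℤ * + (4 ℕ.^ m)             ≡⟨ cong (_* + (4 ℕ.^ m)) (δ-refl {m} 0v) ⟨
    δ {m} 0v 0v * + (4 ℕ.^ m)    ∎
    where open ≡-Reasoning

  -- Fourier transform of a list of vectors and the clique bound

  fourier : List (V m) → V m → ℤ
  fourier L u = ∑L L λ s → χ (h u s)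

  -- The product of the two characters belongs to s + t, which is nonzero in characteristic 2
  -- because s ≠ t.
  χ-orthogonal : ∀ {s t} → s ≢ t → ∑ m (λ u → χ (h u s) * χ (h u t)) ≡ 0ℤ
  χ-orthogonal {s} {t} s≢t = trans
    (∑-cong m λ u → trans (sym (χ-⊕ (h u s) (h u t))) (cong χ (sym (h-+ʳ u s t))))
    (∑χ≡0 (s≢t ∘ +v-cancel s t))

  fourier-orthogonal : ∀ {s L} → All (s ≢_) L → ∑ m (λ u → χ (h u s) * fourier L u) ≡ 0ℤ
  fourier-orthogonal {s} [] = trans (∑-cong m λ u → ℤ.*-zeroʳ (χ (h u s))) (∑-0 m)
  fourier-orthogonal {s} {t ∷ L} (s≢t ∷ s∉L) = begin
    ∑ m (λ u → χ (h u s) * (χ (h u t) + fourier L u))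
      ≡⟨ ∑-cong m (λ u → ℤ.*-distribˡ-+ (χ (h u s)) (χ (h u t)) (fourier L u)) ⟩
    ∑ m (λ u → χ (h u s) * χ (h u t) + χ (h u s) * fourier L u)
      ≡⟨ ∑-+ m _ _ ⟩
    ∑ m (λ u → χ (h u s) * χ (h u t)) + ∑ m (λ u → χ (h u s) * fourier L u)
      ≡⟨ cong₂ _+_ (χ-orthogonal s≢t) (fourier-orthogonal s∉L) ⟩
    0ℤ ∎
    where open ≡-Reasoning

  -- Adding one character at a time avoids a double sum: its square is 1 everywhere and contributes
  -- 4ᵐ, and its cross term with the rest vanishes by `fourier-orthogonal`.
  parseval : ∀ {L} → AllPairs _≢_ L →
    ∑ m (λ u → fourier L u * fourier L u) ≡ + length L * + (4 ℕ.^ m)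
  parseval [] = ∑-0 m
  parseval {s ∷ L} (s∉L ∷ uniq) = begin
    ∑ m (λ u → (χs u + F u) * (χs u + F u))
      ≡⟨ ∑-cong m (λ u → trans (expand (χs u) (F u)) (cong (λ c → c + + 2 * (χs u * F u) + F u * F u) (χ²≡1 (h u s)))) ⟩
    ∑ m (λ u → 1ℤ + + 2 * (χs u * F u) + F u * F u)
      ≡⟨ ∑-+ m (λ u → 1ℤ + + 2 * (χs u * F u)) _ ⟩
    ∑ m (λ u → 1ℤ + + 2 * (χs u * F u)) + ∑ m (λ u → F u * F u)
      ≡⟨ cong₂ _+_ (∑-+ m (λ _ → 1ℤ) _) (parseval uniq) ⟩
    ∑ m (λ _ → 1ℤ) + ∑ m (λ u → + 2 * (χs u * F u)) + + length L * q
      ≡⟨ cong₂ (λ a b → a + b + + length L * q) (∑-1 m) (trans (∑-*ˡ m (+ 2) _) (cong (+ 2 *_) (fourier-orthogonal s∉L))) ⟩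
    q + 0ℤ + + length L * q
      ≡⟨ cong (_+ + length L * q) (ℤ.+-identityʳ q) ⟩
    q + + length L * q
      ≡⟨ ℤ.suc-* (+ length L) q ⟨
    + length (s ∷ L) * q ∎
    where
    open ≡-Reasoning
    q = + (4 ℕ.^ m)
    χs F : V m → ℤ
    χs u = χ (h u s)
    F = fourier L
    expand : ∀ a b → (a + b) * (a + b) ≡ a * a + + 2 * (a * b) + b * b
    expand = solve-∀

  fourier-0 : ∀ L → fourier L 0v ≡ + length L
  fourier-0 L = trans (∑L-cong L λ s → cong χ (h-0ˡ s)) (trans (∑L-const L 1ℤ) (ℤ.*-identityʳ _))

  -- For t = h u c ≠ 0 the three products t, ω²t, ωt run through all nonzero scalars, on which `χ`
  -- takes the values 1, -1, -1.
  fourier-orbits : ∀ {u C} → All (λ c → h u c ≢ 𝟘) C → fourier (orbits C) u ≡ - (+ length C)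
  fourier-orbits [] = refl
  fourier-orbits {u} {c ∷ C} (ne ∷ nes)
    rewrite fourier-orbits nes | h-·ʳ 𝟙 u c | h-·ʳ ω u c | h-·ʳ ω² u c = begin
    χ (𝟙 ⊗ t) + (χ (ω² ⊗ t) + (χ (ω ⊗ t) + - (+ length C)))
      ≡⟨ lemma (χ (𝟙 ⊗ t)) (χ (ω² ⊗ t)) (χ (ω ⊗ t)) (- (+ length C)) ⟩
    χ (𝟙 ⊗ t) + χ (ω² ⊗ t) + χ (ω ⊗ t) + - (+ length C)
      ≡⟨ cong (_+ - (+ length C)) (total t ne) ⟩
    -1ℤ + - (+ length C)
      ≡⟨ ℤ.neg-distrib-+ 1ℤ (+ length C) ⟨
    - (+ length (c ∷ C)) ∎
    where
    open ≡-Reasoning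
    t = h u c
    total : ∀ t → t ≢ 𝟘 → χ (𝟙 ⊗ t) + χ (ω² ⊗ t) + χ (ω ⊗ t) ≡ -1ℤ
    total = from-yes (∀F4? λ t → ¬? (t ≟ 𝟘) →-dec (χ (𝟙 ⊗ t) + χ (ω² ⊗ t) + χ (ω ⊗ t) ℤ.≟ -1ℤ))
    lemma : ∀ a b c d → a + (b + (c + d)) ≡ a + b + c + d
    lemma = solve-∀

  -- The squared Fourier transform of the 3k vectors spanning the points of a clique C of size k
  -- is 9k² at 0 and k² at each of these vectors; Parseval bounds the total by 3k·4ᵐ.
  clique-bound : ∀ {C} → IsClique C → length C ℕ.* (length C ℕ.+ 3) ℕ.≤ 4 ℕ.^ m
  clique-bound {[]} _ = ℕ.z≤n
  clique-bound {C@(_ ∷ _)} ((verts , diff) , adj) =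
    -- Cancelling 3k needs k ≠ 0; the empty clique was split off for this.
    ℕ.*-cancelˡ-≤ (3 ℕ.* k) (ℤ.drop‿+≤+ (begin
      + (3 ℕ.* k ℕ.* (k ℕ.* (k ℕ.+ 3)))       ≡⟨ cong +_ (rearrange k) ⟩
      + (n ℕ.* n ℕ.+ n ℕ.* (k ℕ.* k))         ≡⟨ ℤ.pos-+ (n ℕ.* n) (n ℕ.* (k ℕ.* k)) ⟩
      + (n ℕ.* n) + + (n ℕ.* (k ℕ.* k))       ≡⟨ cong₂ _+_ (ℤ.pos-* n n) (trans (ℤ.pos-* n (k ℕ.* k)) (cong (+ n *_) (ℤ.pos-* k k))) ⟩
      + n * + n + + n * (+ k * + k)           ≡⟨ cong₂ (λ a b → a * a + + n * b) F0 (neg-square (+ k)) ⟨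
      F 0v * F 0v + + n * (- (+ k) * - (+ k)) ≡⟨ cong (λ l → F 0v * F 0v + + l * (- (+ k) * - (+ k))) (length-orbits C) ⟨
      F 0v * F 0v + + length S * (- (+ k) * - (+ k)) ≡⟨ cong (λ s → F 0v * F 0v + s) (∑L-const S (- (+ k) * - (+ k))) ⟨
      F 0v * F 0v + ∑L S (λ _ → - (+ k) * - (+ k))   ≡⟨ cong (λ s → F 0v * F 0v + s) (∑L-congᴬ (All.map (λ e → cong₂ _*_ e e) FS)) ⟨
      ∑L (0v ∷ S) (λ u → F u * F u)                  ≤⟨ ∑L≤∑ m (0∉S ∷ uniq) (λ u → 0≤i*i (F u)) ⟩
      ∑ m (λ u → F u * F u)                          ≡⟨ parseval uniq ⟩
      + length S * + (4 ℕ.^ m)                       ≡⟨ cong (λ l → + l * + (4 ℕ.^ m)) (length-orbits C) ⟩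
      + n * + (4 ℕ.^ m)                              ≡⟨ ℤ.pos-* n (4 ℕ.^ m) ⟨
      + (n ℕ.* 4 ℕ.^ m)                              ∎))
    where
    open ℤ.≤-Reasoning
    k = length C
    n = 3 ℕ.* k
    S = orbits C
    F = fourier S
    norms = vertices⇒norm-𝟙 verts
    uniq = orbits-unique norms diff
    neg-square : ∀ a → - a * - a ≡ a * a
    neg-square = solve-∀
    rearrange : ∀ k → 3 ℕ.* k ℕ.* (k ℕ.* (k ℕ.+ 3)) ≡ 3 ℕ.* k ℕ.* (3 ℕ.* k) ℕ.+ 3 ℕ.* k ℕ.* (k ℕ.* k)
    rearrange = ℕ-Solver.solve-∀
    F0 : F 0v ≡ + n
    F0 = trans (fourier-0 S) (cong +_ (length-orbits C))
    FS : All (λ u → F u ≡ - (+ k)) S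
    FS = All-orbits (λ a x a≢𝟘 nes → fourier-orbits
        (All.map (λ {c} ne e → ⊗-≢𝟘 a (h x c) a≢𝟘 ne (trans (sym (homog a x c)) e)) nes))
      (clique⇒All² norms adj)
    0∉S : All (0v ≢_) S
    0∉S = All-orbits (λ { a x a≢𝟘 hx 0≡ax → scaled-≢0 a a≢𝟘 hx (sym 0≡ax) }) norms

  -- (-1)^h(v,v), written as an additive character of the value of h.
  σ : V m → ℤ
  σ v = χ (ω ⊗ h v v)

  σ-+ : ∀ u v → σ v * σ (u +v v) ≡ σ u * χ (h v u)
  σ-+ u v = trans (cong (λ c → σ v * χ (ω ⊗ c)) (trans (norm-+ u v)
      (cong (λ c → h u u ⊕ h v v ⊕ (c ⊕ conj c)) (hermit v u))))
    (lemma (h u u) (h v v) (h v u))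
    where
    lemma : ∀ p q t →
      χ (ω ⊗ q) * χ (ω ⊗ (p ⊕ q ⊕ (conj t ⊕ conj (conj t)))) ≡ χ (ω ⊗ p) * χ t
    lemma = from-yes (∀F4? λ p → ∀F4? λ q → ∀F4? λ t →
      χ (ω ⊗ q) * χ (ω ⊗ (p ⊕ q ⊕ (conj t ⊕ conj (conj t)))) ℤ.≟ χ (ω ⊗ p) * χ t)

  gauss-sum : ℤ
  gauss-sum = ∑ m σ

  -- Replacing u by u + v in one factor cancels the norm of v, so v survives only in the character
  -- `χ (h v u)`. Summing over v first then leaves the single term u = 0.
  gauss-sum² : gauss-sum * gauss-sum ≡ + (4 ℕ.^ m)
  gauss-sum² = begin
    gauss-sum * gauss-sum                            ≡⟨ ∑-*ʳ m gauss-sum σ ⟨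
    ∑ m (λ v → σ v * gauss-sum)                      ≡⟨ ∑-cong m (λ v → cong (σ v *_) (∑-shift m σ v)) ⟨
    ∑ m (λ v → σ v * ∑ m (λ u → σ (u +v v)))         ≡⟨ ∑-cong m (λ v → ∑-*ˡ m (σ v) (λ u → σ (u +v v))) ⟨
    ∑ m (λ v → ∑ m (λ u → σ v * σ (u +v v)))         ≡⟨ ∑-cong m (λ v → ∑-cong m (λ u → σ-+ u v)) ⟩
    ∑ m (λ v → ∑ m (λ u → σ u * χ (h v u)))          ≡⟨ ∑-swap m m (λ u v → σ u * χ (h v u)) ⟨
    ∑ m (λ u → ∑ m (λ v → σ u * χ (h v u)))          ≡⟨ ∑-cong m (λ u → ∑-*ˡ m (σ u) (λ v → χ (h v u))) ⟩
    ∑ m (λ u → σ u * ∑ m (λ v → χ (h v u)))          ≡⟨ ∑-cong m (λ u → cong (σ u *_) (∑χ≡δ u)) ⟩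
    ∑ m (λ u → σ u * (δ 0v u * q))                   ≡⟨ ∑-cong m (λ u → exchange (σ u) (δ 0v u) q) ⟩
    ∑ m (λ u → δ 0v u * (σ u * q))                   ≡⟨ ∑-δ m 0v (λ u → σ u * q) ⟩
    σ 0v * q                                         ≡⟨ cong (λ c → χ (ω ⊗ c) * q) (h-0ˡ 0v) ⟩
    1ℤ * q                                           ≡⟨ ℤ.*-identityˡ q ⟩
    q                                                ∎
    where
    open ≡-Reasoning
    q = + (4 ℕ.^ m)
    exchange : ∀ a b c → a * (b * c) ≡ b * (a * c)
    exchange = solve-∀

  gauss-sum≤2^m : gauss-sum ≤ + (2 ℕ.^ m)
  gauss-sum≤2^m = i*i≡n*n⇒i≤n gauss-sum (2 ℕ.^ m)
    (trans gauss-sum² (trans (cong +_ (4^n≡2^n*2^n m)) (ℤ.pos-* (2 ℕ.^ m) (2 ℕ.^ m))))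

  -- The points of L carry every v of norm 1, and there are (4ᵐ - gauss-sum) / 2 of those.
  vertex-bound : ∀ {L} → (∀ v → IsVertex v → Any (SamePoint v) L) →
    4 ℕ.^ m ℕ.≤ 2 ℕ.^ m ℕ.+ 6 ℕ.* length L
  vertex-bound {L} complete = ℤ.drop‿+≤+ (begin
    + (4 ℕ.^ m)                                          ≡⟨ ∑-1 m ⟨
    ∑ m (λ _ → 1ℤ)                                       ≤⟨ ∑-mono m covered ⟩
    ∑ m (λ v → σ v + + 2 * ∑L S (λ s → δ s v))            ≡⟨ ∑-+ m σ _ ⟩
    gauss-sum + ∑ m (λ v → + 2 * ∑L S (λ s → δ s v))      ≡⟨ cong (λ c → gauss-sum + c) count ⟩
    gauss-sum + + (6 ℕ.* length L)                       ≤⟨ ℤ.+-monoˡ-≤ (+ (6 ℕ.* length L)) gauss-sum≤2^m ⟩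
    + (2 ℕ.^ m ℕ.+ 6 ℕ.* length L)                       ∎)
    where
    open ℤ.≤-Reasoning
    S = orbits L
    count : ∑ m (λ v → + 2 * ∑L S (λ s → δ s v)) ≡ + (6 ℕ.* length L)
    count = begin-equality
      ∑ m (λ v → + 2 * ∑L S (λ s → δ s v)) ≡⟨ ∑-*ˡ m (+ 2) _ ⟩
      + 2 * ∑ m (λ v → ∑L S (λ s → δ s v)) ≡⟨ cong (+ 2 *_) (∑-∑L m S δ) ⟩
      + 2 * ∑L S (λ s → ∑ m (δ s))         ≡⟨ cong (+ 2 *_) (∑L-cong S (∑-δ-1 m)) ⟩
      + 2 * ∑L S (λ _ → 1ℤ)                ≡⟨ cong (+ 2 *_) (trans (∑L-const S 1ℤ) (ℤ.*-identityʳ (+ length S))) ⟩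
      + 2 * + length S                     ≡⟨ ℤ.pos-* 2 (length S) ⟨
      + (2 ℕ.* length S)                   ≡⟨ cong (λ l → + (2 ℕ.* l)) (length-orbits L) ⟩
      + (2 ℕ.* (3 ℕ.* length L))           ≡⟨ cong +_ (ℕ.*-assoc 2 3 (length L)) ⟨
      + (6 ℕ.* length L)                   ∎
    -- On isotropic vectors σ is already 1. On vectors of norm 1 it is -1, and the weight 2 on at
    -- least one occurrence in `S` makes up the difference.
    covered : ∀ v → 1ℤ ≤ σ v + + 2 * ∑L S (λ s → δ s v)
    covered v with h v v ≟ 𝟘
    ... | yes iso rewrite iso = ℤ.+-monoʳ-≤ 1ℤ (ℤ.*-monoˡ-≤-nonNeg (+ 2) (0≤∑L-δ v S))
    ... | no ne rewrite norm-≢𝟘 v ne = ℤ.+-monoʳ-≤ -1ℤ (ℤ.*-monoˡ-≤-nonNeg (+ 2)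
      (1≤∑L-δ (∈-orbits (complete v ((λ { refl → ne (h-0ˡ 0v) }) , ne)))))

-- Maximal lists and cliques by search

maximum : ∀ {Q : ℕ → Set} → (∀ k → Dec (Q k)) → Q 0 → ∀ B → (∀ j → Q j → j ℕ.≤ B) →
  ∃ λ k → Q k × (∀ j → Q j → j ℕ.≤ k)
maximum Q? q0 zero bound = 0 , q0 , bound
maximum Q? q0 (suc B) bound with Q? (suc B)
... | yes q = suc B , q , bound
... | no ¬q = maximum Q? q0 B λ j q → ℕ.≤-pred (ℕ.≤∧≢⇒< (bound j q) λ { refl → ¬q q })

-- Lists of a fixed length can be searched as vectors, and the bound `B` leaves finitely many
-- lengths to try.
longest : ∀ {A : Set} {P : List A → Set} → Searchable A → (∀ xs → Dec (P xs)) → P [] →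
  ∀ B → (∀ xs → P xs → length xs ℕ.≤ B) →
  ∃ λ xs → P xs × (∀ ys → P ys → length ys ℕ.≤ length xs)
longest {A} {P} any-A? P? p[] B bound
  with maximum hasLength? ([] , p[] , refl) B (λ { _ (xs , p , refl) → bound xs p })
  where
  hasLength? : ∀ k → Dec (∃ λ xs → P xs × length xs ≡ k)
  hasLength? k = map′
    (λ (v , p) → toList v , p , Vec.length-toList v)
    (λ { (xs , p , refl) → fromList xs , subst P (sym (Vec.toList∘fromList xs)) p })
    (any-Vec? any-A? k λ v → P? (toList v))
... | _ , (xs , p , refl) , max = xs , p , λ ys q → max _ (ys , q , refl)

allVectors : ∀ m → List (V m)
allVectors zero = [] ∷ []
allVectors (suc m) = cartesianProductWith _∷_ (𝟘 ∷ 𝟙 ∷ ω ∷ ω² ∷ []) (allVectors m)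

∈-allVectors : ∀ {m} (v : V m) → v ∈ allVectors m
∈-allVectors [] = here refl
∈-allVectors (a ∷ v) = ∈-cartesianProductWith⁺ _∷_ (∈-F4 a) (∈-allVectors v)
  where
  ∈-F4 : ∀ a → a ∈ 𝟘 ∷ 𝟙 ∷ ω ∷ ω² ∷ []
  ∈-F4 𝟘 = here refl
  ∈-F4 𝟙 = there (here refl)
  ∈-F4 ω = there (there (here refl))
  ∈-F4 ω² = there (there (there (here refl)))

module CliqueSearch {A : Set} (_≟ᴬ_ : DecidableEquality A) {R : A → A → Set} (R? : Decidable R) where

  -- Testing against `chosen` before branching confines the search to compatible sets instead of all
  -- subsets, so that it can be evaluated during type checking.
  maxClique : List A → List A → ℕ
  maxClique chosen [] = 0
  maxClique chosen (x ∷ xs) with All.all? (R? x) chosen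
  ... | yes _ = suc (maxClique (x ∷ chosen) xs) ℕ.⊔ maxClique chosen xs
  ... | no _ = maxClique chosen xs

  remove : A → List A → List A
  remove x = filter λ y → ¬? (y ≟ᴬ x)

  length-remove : ∀ x {M} → AllPairs _≢_ M → length M ℕ.≤ suc (length (remove x M))
  length-remove x [] = ℕ.z≤n
  length-remove x {y ∷ M} (y∉M ∷ uniq) with y ≟ᴬ x
  ... | no _ = ℕ.s≤s (length-remove x uniq)
  ... | yes refl rewrite List.filter-all (λ z → ¬? (z ≟ᴬ x)) (All.map (_∘ sym) y∉M) = ℕ.≤-refl

  maxClique-skip : ∀ chosen x xs → maxClique chosen xs ℕ.≤ maxClique chosen (x ∷ xs)
  maxClique-skip chosen x xs with All.all? (R? x) chosen
  ... | yes _ = ℕ.m≤n⊔m (suc (maxClique (x ∷ chosen) xs)) (maxClique chosen xs)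
  ... | no _ = ℕ.≤-refl

  maxClique-take : ∀ {chosen x} xs → All (R x) chosen →
    suc (maxClique (x ∷ chosen) xs) ℕ.≤ maxClique chosen (x ∷ xs)
  maxClique-take {chosen} {x} xs ok with All.all? (R? x) chosen
  ... | yes _ = ℕ.m≤m⊔n (suc (maxClique (x ∷ chosen) xs)) (maxClique chosen xs)
  ... | no ¬ok = contradiction ok ¬ok

  -- `M` may list its elements in any order, so the induction follows the candidates: one that lies
  -- in `M` is moved to `chosen`, and distinctness ensures that `M` loses only one entry.
  length≤maxClique : ∀ xs {chosen M} → AllPairs _≢_ M → (∀ {y} → y ∈ M → y ∈ xs) →
    (∀ {y z} → y ∈ M → z ∈ M → R y z) → (∀ {y c} → y ∈ M → c ∈ chosen → R y c) →
    length M ℕ.≤ maxClique chosen xs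
  length≤maxClique [] {M = []} _ _ _ _ = ℕ.z≤n
  length≤maxClique [] {M = _ ∷ _} _ sub _ _ with sub (here refl)
  ... | ()
  length≤maxClique (x ∷ xs) {chosen} {M} uniq sub pair ext with any? (x ≟ᴬ_) M
  ... | no x∉M = ℕ.≤-trans (length≤maxClique xs uniq sub′ pair ext) (maxClique-skip chosen x xs)
    where
    sub′ : ∀ {y} → y ∈ M → y ∈ xs
    sub′ y∈M with sub y∈M
    ... | here refl = contradiction y∈M x∉M
    ... | there y∈xs = y∈xs
  ... | yes x∈M = begin
    length M                       ≤⟨ length-remove x uniq ⟩
    suc (length (remove x M))      ≤⟨ ℕ.s≤s (length≤maxClique xs (AllPairs.filter⁺ ≢x? uniq) sub′
                                        (λ p q → pair (kept p) (kept q)) ext′) ⟩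
    suc (maxClique (x ∷ chosen) xs)   ≤⟨ maxClique-take xs (All.tabulate (ext x∈M)) ⟩
    maxClique chosen (x ∷ xs)         ∎
    where
    open ℕ.≤-Reasoning
    ≢x? : ∀ y → Dec (y ≢ x)
    ≢x? y = ¬? (y ≟ᴬ x)
    kept : ∀ {y} → y ∈ remove x M → y ∈ M
    kept = proj₁ ∘ ∈-filter⁻ ≢x?
    sub′ : ∀ {y} → y ∈ remove x M → y ∈ xs
    sub′ y∈ with ∈-filter⁻ ≢x? y∈
    ... | y∈M , y≢x with sub y∈M
    ...   | here refl = contradiction refl y≢x
    ...   | there y∈xs = y∈xs
    ext′ : ∀ {y c} → y ∈ remove x M → c ∈ x ∷ chosen → R y c
    ext′ y∈ (here refl) = pair (kept y∈) x∈M
    ext′ y∈ (there c∈) = ext (kept y∈) c∈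

-- Sets of isotropic vectors in F₄³

dot : ∀ {n} → V n → V n → F4
dot [] [] = 𝟘
dot (a ∷ u) (b ∷ v) = a ⊗ conj b ⊕ dot u v

open CliqueSearch {V 3} _≟ᵛ_ {λ t u → dot t u ≢ 𝟙} (λ t u → ¬? (dot t u ≟ 𝟙))

isotropic? : ∀ (t : V 3) → Dec (dot t t ≡ 𝟘)
isotropic? t = dot t t ≟ 𝟘

isotropic-maxClique : maxClique [] (filter isotropic? (allVectors 3)) ℕ.≤ 9
isotropic-maxClique = from-yes (maxClique [] (filter isotropic? (allVectors 3)) ℕ.≤? 9)

isotropic-bound : ∀ {M} → AllPairs _≢_ M → All (λ t → dot t t ≡ 𝟘) M →
  All (λ t → All (λ u → dot t u ≢ 𝟙) M) M → length M ℕ.≤ 9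
isotropic-bound uniq iso pair = ℕ.≤-trans
  (length≤maxClique (filter isotropic? (allVectors 3)) {[]} uniq
    (λ {t} t∈M → ∈-filter⁺ isotropic? (∈-allVectors t) (All.lookup iso t∈M))
    (λ t∈M u∈M → All.lookup (All.lookup pair t∈M) u∈M) (λ _ ()))
  isotropic-maxClique

-- Orthonormal systems

module Orthonormality {m : ℕ} (H : HermitianForm m) where
  open HermitianForm H
  open Hermitian H

  infix 4 _⟂_
  _⟂_ : V m → List (V m) → Set
  w ⟂ E = All (λ e → h w e ≡ 𝟘) E

  _⟂?_ : ∀ w E → Dec (w ⟂ E)
  w ⟂? E = All.all? (λ e → h w e ≟ 𝟘) E

  Orthonormal : List (V m) → Set
  Orthonormal E = All (λ e → h e e ≡ 𝟙) E × AllPairs (λ e f → h e f ≡ 𝟘) E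

  combine : ∀ (E : List (V m)) → V (length E) → V m
  combine [] [] = 0v
  combine (e ∷ E) (a ∷ as) = (a ·v e) +v combine E as

  coords : ∀ (E : List (V m)) → V m → V (length E)
  coords [] v = []
  coords (e ∷ E) v = h v e ∷ coords E v

  ⟂-+ : ∀ {u v E} → u ⟂ E → v ⟂ E → (u +v v) ⟂ E
  ⟂-+ {u} {v} u⟂E v⟂E =
    All.zipWith (λ {e} (p , q) → trans (additive u v e) (cong₂ _⊕_ p q)) (u⟂E , v⟂E)

  combine-⟂ : ∀ {E w} → w ⟂ E → ∀ as → h (combine E as) w ≡ 𝟘
  combine-⟂ {[]} {w} [] [] = h-0ˡ w
  combine-⟂ {e ∷ E} {w} (p ∷ ps) (a ∷ as)
    rewrite additive (a ·v e) (combine E as) w | homog a e w | h-sym-𝟘 p | ⊗-zeroʳ a = combine-⟂ ps as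

  coords-+ : ∀ E u v → coords E (u +v v) ≡ coords E u +v coords E v
  coords-+ [] u v = refl
  coords-+ (e ∷ E) u v = cong₂ _∷_ (additive u v e) (coords-+ E u v)

  coords-⟂ : ∀ {E w} → w ⟂ E → coords E w ≡ 0v
  coords-⟂ [] = refl
  coords-⟂ (p ∷ ps) = cong₂ _∷_ p (coords-⟂ ps)

  coords-0⇒⟂ : ∀ E {w} → coords E w ≡ 0v → w ⟂ E
  coords-0⇒⟂ [] _ = []
  coords-0⇒⟂ (e ∷ E) eq = Vec.∷-injectiveˡ eq ∷ coords-0⇒⟂ E (Vec.∷-injectiveʳ eq)

  coords-combine : ∀ {E} → Orthonormal E → ∀ as → coords E (combine E as) ≡ as
  coords-combine ([] , []) [] = refl
  coords-combine {e ∷ E} (he ∷ hs , os ∷ oss) (a ∷ as) = cong₂ _∷_ first rest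
    where
    open ≡-Reasoning
    first : h ((a ·v e) +v combine E as) e ≡ a
    first = begin
      h ((a ·v e) +v combine E as) e        ≡⟨ additive (a ·v e) (combine E as) e ⟩
      h (a ·v e) e ⊕ h (combine E as) e     ≡⟨ cong₂ _⊕_ (homog a e e) (combine-⟂ os as) ⟩
      a ⊗ h e e ⊕ 𝟘                         ≡⟨ ⊕-identityʳ (a ⊗ h e e) ⟩
      a ⊗ h e e                             ≡⟨ cong (a ⊗_) he ⟩
      a ⊗ 𝟙                                 ≡⟨ ⊗-identityʳ a ⟩
      a                                     ∎
    ae⟂E : (a ·v e) ⟂ E
    ae⟂E = All.map (λ {f} o → trans (homog a e f) (trans (cong (a ⊗_) o) (⊗-zeroʳ a))) os
    rest : coords E ((a ·v e) +v combine E as) ≡ as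
    rest = begin
      coords E ((a ·v e) +v combine E as)             ≡⟨ coords-+ E (a ·v e) (combine E as) ⟩
      coords E (a ·v e) +v coords E (combine E as)    ≡⟨ cong₂ _+v_ (coords-⟂ ae⟂E) (coords-combine (hs , oss) as) ⟩
      0v +v as                                        ≡⟨ Vec.zipWith-identityˡ (λ _ → refl) as ⟩
      as                                              ∎

  h-combine : ∀ E as w → h (combine E as) w ≡ dot as (coords E w)
  h-combine [] [] w = h-0ˡ w
  h-combine (e ∷ E) (a ∷ as) w = trans (additive (a ·v e) (combine E as) w)
    (cong₂ _⊕_ (trans (homog a e w) (cong (a ⊗_) (hermit w e))) (h-combine E as w))

  orthonormal-length : ∀ {E} → Orthonormal E → length E ℕ.≤ m
  orthonormal-length {E} on = retraction⇒≤ (combine E) (coords E) (coords-combine on)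

  Extension : List (V m) → Set
  Extension E = ∃ λ e → h e e ≡ 𝟙 × e ⟂ E

  extend : ∀ {E} → Orthonormal E → (ext : Extension E) → Orthonormal (proj₁ ext ∷ E)
  extend (hs , os) (e , he , e⟂E) = he ∷ hs , e⟂E ∷ os

  -- In characteristic 2 this is v minus its orthogonal projection when `E` is orthonormal.
  residual : List (V m) → V m → V m
  residual E v = v +v combine E (coords E v)

  residual-⟂ : ∀ {E} → Orthonormal E → ∀ v → residual E v ⟂ E
  residual-⟂ {E} on v = coords-0⇒⟂ E (begin
    coords E (residual E v)                               ≡⟨ coords-+ E v (combine E (coords E v)) ⟩
    coords E v +v coords E (combine E (coords E v))       ≡⟨ cong (coords E v +v_) (coords-combine on (coords E v)) ⟩
    coords E v +v coords E v                              ≡⟨ +v-self (coords E v) ⟩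
    0v                                                    ∎)
    where open ≡-Reasoning

  module _ (nondeg : Nondegenerate H) where
    open Nondeg H nondeg using (h-surjective)

    -- E^⊥ is nondegenerate, so if it were nonzero and totally isotropic it would contain
    -- r and w with h w r = ω, and then w + r has norm ω + ω² = 1.
    unextendable⇒spanning : ∀ {E} → Orthonormal E → ¬ Extension E → ∀ v → combine E (coords E v) ≡ v
    unextendable⇒spanning {E} on ¬ext v with residual E v ≟ᵛ 0v
    ... | yes r≡0 = sym (+v-cancel v _ r≡0)
    ... | no r≢0 with h-surjective r≢0 ω
    ...   | u , hu≡ω = contradiction
      (w +v r , norm , ⟂-+ (residual-⟂ on u) (residual-⟂ on v)) ¬ext
      where
      r = residual E v
      w = residual E u
      isotropic : ∀ {x} → x ⟂ E → h x x ≡ 𝟘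
      isotropic {x} x⟂E = decidable-stable (h x x ≟ 𝟘) λ ne → ¬ext (x , norm-≢𝟘 x ne , x⟂E)
      -- Passing from `u` to its residual changes it by a combination of `E`, which is orthogonal to
      -- `r`.
      hw≡ω : h w r ≡ ω
      hw≡ω = trans (additive u (combine E (coords E u)) r)
        (cong₂ _⊕_ hu≡ω (combine-⟂ (residual-⟂ on v) (coords E u)))
      norm : h (w +v r) (w +v r) ≡ 𝟙
      norm rewrite norm-+ w r | isotropic (residual-⟂ on u) | isotropic (residual-⟂ on v) | hw≡ω = refl

    -- Otherwise `E` would span, making `coords E` injective with retraction `combine E`, and
    -- counting would give m ≤ length E.
    extension : ∀ {E} → Orthonormal E → length E < m → Extension E
    extension {E} on short with any-Vec? any-F4? m (λ e → (h e e ≟ 𝟙) ×-dec (e ⟂? E))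
    ... | yes ext = ext
    ... | no ¬ext = contradiction
      (retraction⇒≤ (coords E) (combine E) (unextendable⇒spanning on ¬ext)) (ℕ.<⇒≱ short)

    basis-spanning : ∀ {E} → Orthonormal E → length E ≡ m → ∀ v → combine E (coords E v) ≡ v
    basis-spanning on eq = unextendable⇒spanning on λ ext →
      ℕ.<⇒≱ (orthonormal-length (extend on ext)) (ℕ.≤-reflexive (sym eq))

-- The clique and coclique bounds

module Bounds {m : ℕ} (H : HermitianForm m) (nondeg : Nondegenerate H) where
  open HermitianForm H
  open NU H
  open Hermitian H
  open Orthonormality H

  coclique-bound : ∀ {L} → IsCoclique L → length L ℕ.≤ m
  coclique-bound ((verts , diff) , nonadj) = orthonormal-length
    (norms , AllPairs-mapᴬ
      (λ {x} {y} hx hy (¬same , ¬adj) → decidable-stable (h x y ≟ 𝟘) λ ne → ¬adj (h≢𝟘⇒Adj hx hy ¬same ne))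
      norms (AllPairs.zip (diff , nonadj)))
    where norms = vertices⇒norm-𝟙 verts

  -- In an orthonormal basis containing x₀, every point of the clique has a unique representative
  -- whose x₀-coordinate is 1; its other three coordinates form an isotropic vector.
  clique-bound-4 : m ≡ 4 → ∀ {C} → IsClique C → length C ℕ.≤ 9
  clique-bound-4 m≡4 {[]} _ = ℕ.z≤n
  clique-bound-4 m≡4 {C@(x₀ ∷ _)} ((verts , diff) , adj) =
    subst (ℕ._≤ 9) (List.length-map tail C)
      (isotropic-bound
        (AllPairs.map⁺ (AllPairs-mapᴬ tail-injective members diff))
        (All.map⁺ (All.map tail-isotropic members))
        (All.map⁺ (All.zipWith (λ (x∈ , nes) → All.map⁺ (All.zipWith (λ (y∈ , ne) → tail-compatible x∈ y∈ ne) (members , nes)))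
          (members , pairwise))))
    where
    norms = vertices⇒norm-𝟙 verts
    pairwise = clique⇒All² norms adj
    Member : V m → Set
    Member c = h c c ≡ 𝟙 × h c x₀ ≢ 𝟘
    members : All Member C
    members = All.zip (norms , All.map h-sym-≢𝟘 (All.head pairwise))

    E₁ = x₀ ∷ []
    on₁ : Orthonormal E₁
    on₁ = All.head norms ∷ [] , [] ∷ []
    short : ∀ k → k < 4 → k < m
    short k = subst (k <_) (sym m≡4)
    ext₂ = extension nondeg on₁ (short 1 (ℕ.s≤s (ℕ.s≤s ℕ.z≤n)))
    on₂ = extend on₁ ext₂
    ext₃ = extension nondeg on₂ (short 2 (ℕ.s≤s (ℕ.s≤s (ℕ.s≤s ℕ.z≤n))))
    on₃ = extend on₂ ext₃
    ext₄ = extension nondeg on₃ (short 3 (ℕ.s≤s (ℕ.s≤s (ℕ.s≤s (ℕ.s≤s ℕ.z≤n)))))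
    on₄ = extend on₃ ext₄
    E : List (V m)
    E = proj₁ ext₄ ∷ proj₁ ext₃ ∷ proj₁ ext₂ ∷ x₀ ∷ []
    spanning : ∀ v → combine E (coords E v) ≡ v
    spanning = basis-spanning nondeg on₄ (sym m≡4)

    -- This is the inverse of h c x₀, so it scales the x₀-coordinate of `c` to 1. That coordinate
    -- comes last because extensions are prepended to `x₀`.
    scalar : V m → F4
    scalar c = conj (h c x₀)
    scalar≢𝟘 : ∀ {c} → Member c → scalar c ≢ 𝟘
    scalar≢𝟘 {c} (_ , ne) = conj-≢𝟘 (h c x₀) ne
    normalise : V m → V m
    normalise c = scalar c ·v c
    tail : V m → V 3
    tail c = coords (proj₁ ext₄ ∷ proj₁ ext₃ ∷ proj₁ ext₂ ∷ []) (normalise c)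
    full : V 3 → V 4
    full (a ∷ b ∷ c ∷ []) = a ∷ b ∷ c ∷ 𝟙 ∷ []
    coords-normalise : ∀ {c} → Member c → coords E (normalise c) ≡ full (tail c)
    coords-normalise {c} (_ , ne) = cong
      (λ a → h (normalise c) (proj₁ ext₄) ∷ h (normalise c) (proj₁ ext₃) ∷ h (normalise c) (proj₁ ext₂) ∷ a ∷ [])
      (trans (homog (scalar c) c x₀) (conj-inverseˡ (h c x₀) ne))
    dot-full : ∀ t u → dot (full t) (full u) ≡ dot t u ⊕ 𝟙
    dot-full (a ∷ b ∷ c ∷ []) (a' ∷ b' ∷ c' ∷ []) = lemma (a ⊗ conj a') (b ⊗ conj b') (c ⊗ conj c')
      where
      lemma : ∀ p q r → p ⊕ (q ⊕ (r ⊕ 𝟙)) ≡ p ⊕ (q ⊕ (r ⊕ 𝟘)) ⊕ 𝟙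
      lemma = from-yes (∀F4? λ p → ∀F4? λ q → ∀F4? λ r → p ⊕ (q ⊕ (r ⊕ 𝟙)) ≟ p ⊕ (q ⊕ (r ⊕ 𝟘)) ⊕ 𝟙)
    h-normalise : ∀ {c d} → Member c → Member d → h (normalise c) (normalise d) ≡ dot (tail c) (tail d) ⊕ 𝟙
    h-normalise {c} {d} c∈ d∈ = begin
      h (normalise c) (normalise d)
        ≡⟨ cong (λ v → h v (normalise d)) (spanning (normalise c)) ⟨
      h (combine E (coords E (normalise c))) (normalise d)
        ≡⟨ h-combine E (coords E (normalise c)) (normalise d) ⟩
      dot (coords E (normalise c)) (coords E (normalise d))
        ≡⟨ cong₂ dot (coords-normalise c∈) (coords-normalise d∈) ⟩
      dot (full (tail c)) (full (tail d))
        ≡⟨ dot-full (tail c) (tail d) ⟩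
      dot (tail c) (tail d) ⊕ 𝟙 ∎
      where open ≡-Reasoning
    h-normalise-≢𝟘 : ∀ {c d} → Member c → Member d → h c d ≢ 𝟘 → h (normalise c) (normalise d) ≢ 𝟘
    h-normalise-≢𝟘 {c} {d} c∈ d∈ ne e = ⊗-≢𝟘 (scalar c) (conj (scalar d) ⊗ h c d) (scalar≢𝟘 c∈)
      (⊗-≢𝟘 (conj (scalar d)) (h c d) (conj-≢𝟘 (scalar d) (scalar≢𝟘 d∈)) ne)
      (trans (sym (trans (homog (scalar c) c (normalise d)) (cong (scalar c ⊗_) (h-·ʳ (scalar d) c d)))) e)
    tail-compatible : ∀ {c d} → Member c → Member d → h c d ≢ 𝟘 → dot (tail c) (tail d) ≢ 𝟙
    tail-compatible c∈ d∈ ne e =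
      h-normalise-≢𝟘 c∈ d∈ ne (trans (h-normalise c∈ d∈) (cong (_⊕ 𝟙) e))
    tail-isotropic : ∀ {c} → Member c → dot (tail c) (tail c) ≡ 𝟘
    tail-isotropic {c} c∈@(hc , _) = lemma _
      (trans (sym (h-normalise c∈ c∈)) (norm-≢𝟘 (normalise c) (h-normalise-≢𝟘 c∈ c∈ λ e → contradiction (trans (sym hc) e) λ ())))
      where
      lemma : ∀ a → a ⊕ 𝟙 ≡ 𝟙 → a ≡ 𝟘
      lemma = from-yes (∀F4? λ a → (a ⊕ 𝟙 ≟ 𝟙) →-dec (a ≟ 𝟘))
    tail-injective : ∀ {c d} → Member c → Member d → ¬ SamePoint c d → tail c ≢ tail d
    tail-injective {c} {d} c∈ d∈ ¬same e = ¬same (SamePoint-≡ (scalar c) (scalar d) c d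
      (scalar≢𝟘 c∈) (scalar≢𝟘 d∈) (begin
        normalise c                              ≡⟨ spanning (normalise c) ⟨
        combine E (coords E (normalise c))       ≡⟨ cong (combine E) (coords-normalise c∈) ⟩
        combine E (full (tail c))                ≡⟨ cong (λ t → combine E (full t)) e ⟩
        combine E (full (tail d))                ≡⟨ cong (combine E) (coords-normalise d∈) ⟨
        combine E (coords E (normalise d))       ≡⟨ spanning (normalise d) ⟩
        normalise d                              ∎))
      where open ≡-Reasoning

-- Decidability of adjacency and existence of extremal lists

module Existence {m : ℕ} (H : HermitianForm m) where
  open HermitianForm H
  open NU H

  any-V? : Searchable (V m)
  any-V? = any-Vec? any-F4? m

  SamePoint? : Decidable (SamePoint {m})
  SamePoint? x y = any-F4? λ c → ¬? (c ≟ 𝟘) ×-dec (y ≟ᵛ (c ·v x))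

  InSpan? : ∀ x y z → Dec (InSpan {m} x y z)
  InSpan? x y z = any-F4? λ a → any-F4? λ b → z ≟ᵛ ((a ·v x) +v (b ·v y))

  Adj? : Decidable Adj
  Adj? x y = ¬? (SamePoint? x y) ×-dec
    any-V? λ z → InSpan? x y z ×-dec (¬? (z ≟ᵛ 0v) ×-dec ((h z z ≟ 𝟘) ×-dec
      all? any-V? λ z' → InSpan? x y z' →-dec (¬? (z' ≟ᵛ 0v) →-dec ((h z' z' ≟ 𝟘) →-dec SamePoint? z z'))))

  IsVertexSet? : ∀ L → Dec (IsVertexSet L)
  IsVertexSet? L = All.all? (λ x → ¬? (x ≟ᵛ 0v) ×-dec ¬? (h x x ≟ 𝟘)) L
    ×-dec allPairs? (λ x y → ¬? (SamePoint? x y)) L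

  -- Distinct points have distinct representatives. This crude bound serves only to make the
  -- searches finite.
  vertex-set-bound : ∀ L → IsVertexSet L → length L ℕ.≤ 4 ℕ.^ m
  vertex-set-bound L (_ , diff) = ℤ.drop‿+≤+ (begin
    + length L          ≡⟨ trans (∑L-const L 1ℤ) (ℤ.*-identityʳ (+ length L)) ⟨
    ∑L L (λ _ → 1ℤ)     ≤⟨ ∑L≤∑ m (AllPairs.map distinct diff) (λ _ → +≤+ ℕ.z≤n) ⟩
    ∑ m (λ _ → 1ℤ)      ≡⟨ ∑-1 m ⟩
    + (4 ℕ.^ m)         ∎)
    where
    open ℤ.≤-Reasoning
    distinct : ∀ {x y : V m} → ¬ SamePoint x y → x ≢ y
    distinct {x} ¬same refl = ¬same (𝟙 , (λ ()) , sym (𝟙·v x))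

  maximum-clique : ∃ λ L → IsClique L × (∀ L' → IsClique L' → length L' ℕ.≤ length L)
  maximum-clique = longest any-V? (λ L → IsVertexSet? L ×-dec allPairs? Adj? L)
    (([] , []) , []) (4 ℕ.^ m) (λ L → vertex-set-bound L ∘ proj₁)

  maximum-coclique : ∃ λ L → IsCoclique L × (∀ L' → IsCoclique L' → length L' ℕ.≤ length L)
  maximum-coclique = longest any-V? (λ L → IsVertexSet? L ×-dec allPairs? (λ x y → ¬? (Adj? x y)) L)
    (([] , []) , []) (4 ℕ.^ m) (λ L → vertex-set-bound L ∘ proj₁)

  -- A longest vertex set is complete: a missing point could be prepended to it.
  all-vertices : ∃ λ L → IsVertexSet L × (∀ x → IsVertex x → Any (SamePoint x) L)
  all-vertices with longest any-V? IsVertexSet? ([] , []) (4 ℕ.^ m) vertex-set-bound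
  ... | L , verts@(all , diff) , max = L , verts , complete
    where
    complete : ∀ x → IsVertex x → Any (SamePoint x) L
    complete x vx = decidable-stable (any? (SamePoint? x) L) λ new →
      ℕ.1+n≰n (max (x ∷ L) (vx ∷ all , All.¬Any⇒All¬ L new ∷ diff))

-- Comparison of the bounds

-- The inequality starts at 30 ≤ 32 and fails at m = 4, where 24 > 16; this is where the general
-- comparison breaks off.
6m≤2^m : ∀ {m} → 5 ℕ.≤ m → 6 ℕ.* m ℕ.≤ 2 ℕ.^ m
6m≤2^m 5≤m = subst (λ m → 6 ℕ.* m ℕ.≤ 2 ℕ.^ m) (ℕ.m+[n∸m]≡n 5≤m) (from5 _)
  where
  open ℕ.≤-Reasoning
  from5 : ∀ d → 6 ℕ.* (5 ℕ.+ d) ℕ.≤ 2 ℕ.^ (5 ℕ.+ d)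
  from5 zero = from-yes (30 ℕ.≤? 32)
  from5 (suc d) = begin
    6 ℕ.* (6 ℕ.+ d)                    ≡⟨ step d ⟩
    6 ℕ.+ 6 ℕ.* (5 ℕ.+ d)              ≤⟨ ℕ.+-monoˡ-≤ (6 ℕ.* (5 ℕ.+ d)) (ℕ.*-monoʳ-≤ 6 {1} {5 ℕ.+ d} (ℕ.s≤s ℕ.z≤n)) ⟩
    6 ℕ.* (5 ℕ.+ d) ℕ.+ 6 ℕ.* (5 ℕ.+ d) ≤⟨ ℕ.+-mono-≤ (from5 d) (from5 d) ⟩
    2 ℕ.^ (5 ℕ.+ d) ℕ.+ 2 ℕ.^ (5 ℕ.+ d) ≡⟨ cong (2 ℕ.^ (5 ℕ.+ d) ℕ.+_) (ℕ.+-identityʳ (2 ℕ.^ (5 ℕ.+ d))) ⟨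
    2 ℕ.^ (6 ℕ.+ d)                    ∎
    where
    step : ∀ d → 6 ℕ.* (6 ℕ.+ d) ≡ 6 ℕ.+ 6 ℕ.* (5 ℕ.+ d)
    step = ℕ-Solver.solve-∀

product-bound-4 : ∀ {k a n} → k ℕ.≤ 9 → a ℕ.≤ 4 → 256 ℕ.≤ 16 ℕ.+ 6 ℕ.* n → k ℕ.* a < n
product-bound-4 {k} {a} {n} k≤9 a≤4 count = ℕ.≤-<-trans (ℕ.*-mono-≤ k≤9 a≤4)
  -- Here 36 = 9·4 and 232 = 16 + 6·36.
  (ℕ.≰⇒> λ n≤36 → contradiction
    (ℕ.≤-trans count (ℕ.+-monoʳ-≤ 16 (ℕ.*-monoʳ-≤ 6 n≤36))) (from-yes (¬? (256 ℕ.≤? 232))))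

-- If q ≤ k + 1, then k² + 3k ≤ k² + 2k + 1, so k ≤ 1 and q ≤ 2.
k[k+3]≤q²⇒k+2≤q : ∀ {k q} → 3 ℕ.≤ q → k ℕ.* (k ℕ.+ 3) ℕ.≤ q ℕ.* q → k ℕ.+ 2 ℕ.≤ q
k[k+3]≤q²⇒k+2≤q {k} {q} 3≤q le with k ℕ.+ 2 ℕ.≤? q
... | yes ok = ok
... | no ¬ok = contradiction (ℕ.≤-trans 3≤q (ℕ.≤-trans q≤1+k (ℕ.s≤s k≤1))) (from-yes (¬? (3 ℕ.≤? 2)))
  where
  open ℕ.≤-Reasoning
  q≤1+k : q ℕ.≤ suc k
  q≤1+k = ℕ.≤-pred (subst (q <_) (ℕ.+-comm k 2) (ℕ.≰⇒> ¬ok))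
  split : ∀ k → k ℕ.* (k ℕ.+ 2) ℕ.+ k ≡ k ℕ.* (k ℕ.+ 3)
  split = ℕ-Solver.solve-∀
  square : ∀ k → suc k ℕ.* suc k ≡ k ℕ.* (k ℕ.+ 2) ℕ.+ 1
  square = ℕ-Solver.solve-∀
  k≤1 : k ℕ.≤ 1
  k≤1 = ℕ.+-cancelˡ-≤ (k ℕ.* (k ℕ.+ 2)) k 1 (begin
    k ℕ.* (k ℕ.+ 2) ℕ.+ k   ≡⟨ split k ⟩
    k ℕ.* (k ℕ.+ 3)         ≤⟨ le ⟩
    q ℕ.* q                 ≤⟨ ℕ.*-mono-≤ q≤1+k q≤1+k ⟩
    suc k ℕ.* suc k         ≡⟨ square k ⟩
    k ℕ.* (k ℕ.+ 2) ℕ.+ 1   ∎)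

-- With q = 2ᵐ, 6n ≥ q² - q ≥ (k + 2)q - q = (k + 1)q > kq ≥ 6km ≥ 6ka.
product-bound : ∀ {k a m n} → 5 ℕ.≤ m → k ℕ.* (k ℕ.+ 3) ℕ.≤ 4 ℕ.^ m → a ℕ.≤ m →
  4 ℕ.^ m ℕ.≤ 2 ℕ.^ m ℕ.+ 6 ℕ.* n → k ℕ.* a < n
product-bound {k} {a} {m} {n} 5≤m clique coclique count = ℕ.*-cancelˡ-< 6 (k ℕ.* a) n (begin-strict
  6 ℕ.* (k ℕ.* a)   ≡⟨ swap k a ⟩
  k ℕ.* (6 ℕ.* a)   ≤⟨ ℕ.*-monoʳ-≤ k (ℕ.*-monoʳ-≤ 6 coclique) ⟩
  k ℕ.* (6 ℕ.* m)   ≤⟨ ℕ.*-monoʳ-≤ k (6m≤2^m 5≤m) ⟩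
  k ℕ.* q           <⟨ ℕ.m<n+m (k ℕ.* q) 0<q ⟩
  q ℕ.+ k ℕ.* q     ≤⟨ ℕ.+-cancelˡ-≤ q _ _ (begin
    q ℕ.+ (q ℕ.+ k ℕ.* q) ≡⟨ collect k q ⟩
    (k ℕ.+ 2) ℕ.* q       ≤⟨ ℕ.*-monoˡ-≤ q (k[k+3]≤q²⇒k+2≤q {k} 3≤q (subst (k ℕ.* (k ℕ.+ 3) ℕ.≤_) (4^n≡2^n*2^n m) clique)) ⟩
    q ℕ.* q               ≡⟨ 4^n≡2^n*2^n m ⟨
    4 ℕ.^ m               ≤⟨ count ⟩
    q ℕ.+ 6 ℕ.* n         ∎) ⟩
  6 ℕ.* n           ∎)
  where
  open ℕ.≤-Reasoning
  q = 2 ℕ.^ m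
  3≤q : 3 ℕ.≤ q
  3≤q = ℕ.≤-trans (from-yes (3 ℕ.≤? 30)) (ℕ.≤-trans (ℕ.*-monoʳ-≤ 6 5≤m) (6m≤2^m 5≤m))
  0<q : 0 < q
  0<q = ℕ.≤-trans (ℕ.s≤s ℕ.z≤n) 3≤q
  swap : ∀ k a → 6 ℕ.* (k ℕ.* a) ≡ k ℕ.* (6 ℕ.* a)
  swap = ℕ-Solver.solve-∀
  collect : ∀ k q → q ℕ.+ (q ℕ.+ k ℕ.* q) ≡ (k ℕ.+ 2) ℕ.* q
  collect = ℕ-Solver.solve-∀

theorem3p2 : (m : ℕ) → 3 < m → (H : HermitianForm m) → Nondegenerate H →
    NU.Separating H
theorem3p2 m 3<m H nondeg with Existence.maximum-clique H | Existence.maximum-coclique H | Existence.all-vertices H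
... | C , clique , max | D , coclique , max' | L , verts , complete =
  length C , length D , length L ,
  ((C , clique , refl) , max) , ((D , coclique , refl) , max') , (L , verts , complete , refl) ,
  separated (ℕ.m≤n⇒m<n∨m≡n 3<m)
  where
  open Bounds H nondeg
  open Nondeg H nondeg using (clique-bound; vertex-bound)
  separated : 4 < m ⊎ 4 ≡ m → length C ℕ.* length D < length L
  separated (inj₁ 5≤m) =
    product-bound {length C} 5≤m (clique-bound clique) (coclique-bound coclique) (vertex-bound complete)
  separated (inj₂ 4≡m) =
    product-bound-4 (clique-bound-4 (sym 4≡m) clique)
      (subst (length D ℕ.≤_) (sym 4≡m) (coclique-bound coclique))
      (subst (λ m → 4 ℕ.^ m ℕ.≤ 2 ℕ.^ m ℕ.+ 6 ℕ.* length L) (sym 4≡m) (vertex-bound complete))
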